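{- Let $F$ be a graph and let $e$ be any edge of $F$. Then $\mathrm{th}(F)\le R(K_{\chi(F)},F\setminus e)$.
   Context: A hypergraph $\mathcal{H}$ is a Berge copy of a graph $G$ (Berge-$G$) if $V(G)\subseteq V(\mathcal{H})$ and there is a bijection $f:E(G)\to E(\mathcal{H})$ with $e\subseteq f(e)$ for every $e\in E(G)$; $G$ is then called the core. $\mathrm{ex}_r(n,\text{Berge- }F)$ denotes the maximum number of hyperedges in an $r$-uniform $n$-vertex hypergraph containing no Berge copy of $F$. It is known that for every graph $F$ there is an integer $r_0$ such that $\mathrm{ex}_r(n,\text{Berge- }F)=o(n^2)$ (as $n\to\infty$) for every $r\ge r_0$; the uniformity threshold $\mathrm{th}(F)$ is the smallest such $r_0$. $\chi(F)$ is the chromatic number, $F\setminus e$ is the graph obtained from $F$ by deleting the edge $e$, and $R(H,G)$ is the off-diagonal Ramsey number: the smallest $N$ such that every red/blue coloring of the edges of $K_N$ contains a blue copy of $H$ or a red copy of $G$. -}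

module Defs where

open import Data.Bool using (Bool; false; T; not; _∧_; _∨_)
open import Data.Bool.Properties using (∧-comm; ∨-comm)
open import Data.Fin using (Fin; _<_; _≟_)
open import Data.Fin.Subset using (Subset; ⁅_⁆; _∪_; _⊆_; ∣_∣)
open import Data.Nat using (ℕ; _*_; _^_; _≤_)
open import Data.Product using (∃-syntax; Σ-syntax; _×_)
open import Data.Sum using (_⊎_)
open import Function using (Injective; _↣_; _⤖_; Injection; Bijection)
open import Relation.Binary.PropositionalEquality
  using (_≡_; _≢_; refl; sym; cong; cong₂; trans)
open import Relation.Nullary using (¬_; yes; no; contradiction)
open import Relation.Nullary.Decidable using (⌊_⌋)

IsLeast : (ℕ → Set) → ℕ → Set
IsLeast P m = P m × (∀ k → P k → m ≤ k)

IsGreatest : (ℕ → Set) → ℕ → Set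
IsGreatest P m = P m × (∀ k → P k → k ≤ m)

record Graph : Set where
  field
    order      : ℕ
    adj        : Fin order → Fin order → Bool
    adj-sym    : ∀ u v → adj u v ≡ adj v u
    adj-irrefl : ∀ u → adj u u ≡ false

open Graph public

-- Listing the smaller endpoint first makes each edge an element exactly once.
record Edge (G : Graph) : Set where
  field
    fst snd  : Fin (order G)
    fst<snd  : fst < snd
    adjacent : T (adj G fst snd)

open Edge public

K : ℕ → Graph
K n = record
  { order      = n
  ; adj        = λ u v → not ⌊ u ≟ v ⌋
  ; adj-sym    = λ u v → cong not (≟-sym u v)
  ; adj-irrefl = irrefl
  }
  where
  ≟-sym : ∀ (u v : Fin n) → ⌊ u ≟ v ⌋ ≡ ⌊ v ≟ u ⌋
  ≟-sym u v with u ≟ v | v ≟ u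
  ... | yes _ | yes _ = refl
  ... | no  _ | no  _ = refl
  ... | yes p | no ¬q = contradiction (sym p) ¬q
  ... | no ¬p | yes q = contradiction (sym q) ¬p

  irrefl : ∀ (u : Fin n) → not ⌊ u ≟ u ⌋ ≡ false
  irrefl u with u ≟ u
  ... | yes _ = refl
  ... | no ¬p = contradiction refl ¬p

infixl 6 _∖_

_∖_ : (G : Graph) → Edge G → Graph
G ∖ e = record
  { order      = order G
  ; adj        = λ u v → adj G u v ∧ not (joins u v)
  ; adj-sym    = λ u v → cong₂ (λ a b → a ∧ not b) (adj-sym G u v) (joins-sym u v)
  ; adj-irrefl = λ u → cong (_∧ not (joins u u)) (adj-irrefl G u)
  }
  where
  joins : Fin (order G) → Fin (order G) → Bool
  joins u v = (⌊ u ≟ fst e ⌋ ∧ ⌊ v ≟ snd e ⌋) ∨ (⌊ u ≟ snd e ⌋ ∧ ⌊ v ≟ fst e ⌋)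

  joins-sym : ∀ u v → joins u v ≡ joins v u
  joins-sym u v = trans
    (∨-comm (⌊ u ≟ fst e ⌋ ∧ ⌊ v ≟ snd e ⌋) (⌊ u ≟ snd e ⌋ ∧ ⌊ v ≟ fst e ⌋))
    (cong₂ _∨_ (∧-comm ⌊ u ≟ snd e ⌋ ⌊ v ≟ fst e ⌋)
               (∧-comm ⌊ u ≟ fst e ⌋ ⌊ v ≟ snd e ⌋))

Colourable : Graph → ℕ → Set
Colourable G c =
  Σ[ col ∈ (Fin (order G) → Fin c) ] (∀ u v → T (adj G u v) → col u ≢ col v)

IsChromaticNumber : Graph → ℕ → Set
IsChromaticNumber G = IsLeast (Colourable G)

data Colour : Set where
  red blue : Colour

-- A colouring of the edges of K n as a symmetric function of the endpoints;
-- values on the diagonal are never used.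
record EdgeColouring (n : ℕ) : Set where
  field
    colour     : Fin n → Fin n → Colour
    colour-sym : ∀ u v → colour u v ≡ colour v u

open EdgeColouring public

-- Copies need not be induced.
HasCopy : ∀ {n} → EdgeColouring n → Colour → Graph → Set
HasCopy {n} κ x G =
  Σ[ φ ∈ Fin (order G) ↣ Fin n ]
    (∀ u v → T (adj G u v) → colour κ (Injection.to φ u) (Injection.to φ v) ≡ x)

IsRamseyNumber : Graph → Graph → ℕ → Set
IsRamseyNumber H G =
  IsLeast (λ N → (κ : EdgeColouring N) → HasCopy κ blue H ⊎ HasCopy κ red G)

record Hypergraph (n : ℕ) : Set where
  field
    size           : ℕ
    edge           : Fin size → Subset n
    edge-injective : Injective _≡_ _≡_ edge

open Hypergraph public

Uniform : ∀ {n} → ℕ → Hypergraph n → Set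
Uniform r H = ∀ i → ∣ edge H i ∣ ≡ r

Subhypergraph : ∀ {n} → Hypergraph n → Hypergraph n → Set
Subhypergraph H′ H = ∀ i → ∃[ j ] edge H′ i ≡ edge H j

-- The injection φ places the core inside the vertex set of the hypergraph.
IsBergeCopy : ∀ {n} → Graph → Hypergraph n → Set
IsBergeCopy {n} G H =
  Σ[ φ ∈ Fin (order G) ↣ Fin n ]
  Σ[ f ∈ Edge G ⤖ Fin (size H) ]
    (∀ e → ⁅ Injection.to φ (fst e) ⁆ ∪ ⁅ Injection.to φ (snd e) ⁆
             ⊆ edge H (Bijection.to f e))

-- Vertices outside the core do not affect being a Berge copy, so it suffices
-- to consider subhypergraphs on the whole vertex set.
ContainsBerge : ∀ {n} → Graph → Hypergraph n → Set
ContainsBerge {n} F H =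
  Σ[ H′ ∈ Hypergraph n ] (Subhypergraph H′ H × IsBergeCopy F H′)

-- IsEx r F n m  says that  ex_r(n, Berge-F) = m.
IsEx : ℕ → Graph → ℕ → ℕ → Set
IsEx r F n = IsGreatest λ m →
  Σ[ H ∈ Hypergraph n ] (Uniform r H × ¬ ContainsBerge F H × size H ≡ m)

-- The sequence is given by its graph: a n m  says that its n-th term is m.
-- The reciprocal of ε is the natural number k; k = 0 gives no condition.
IsLittleO : (ℕ → ℕ → Set) → (ℕ → ℕ) → Set
IsLittleO a g =
  ∀ k → ∃[ n₀ ] (∀ n → n₀ ≤ n → ∀ m → a n m → k * m ≤ g n)

IsUniformityThreshold : Graph → ℕ → Set
IsUniformityThreshold F =
  IsLeast (λ r₀ → ∀ r → r₀ ≤ r → IsLittleO (IsEx r F) (λ n → n ^ 2))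

{-# OPTIONS --safe #-}
module Submission where

-- In an r-uniform Berge-F-free hypergraph call a pair of vertices heavy if it lies in more than |E(F)|
-- hyperedges. A hyperedge containing a heavy F ∖ e would give a Berge-F: assign it to e and choose the
-- other hyperedges greedily. So by Ramsey's theorem every hyperedge contains a clique K_χ of light pairs, its
-- block. Let G be the union of the blocks; deleting an edge of G destroys boundedly many blocks.
-- Partition the vertices so that, up to few edges of G, any two parts are "lower-regular": no large
-- subsets of them span a sparse pair. If all the blocks are destroyed by deleting the exceptional edges,
-- there are few hyperedges. Otherwise some block survives, and F embeds greedily, each colour class
-- into one of the parts met by that block. Never choosing a vertex on a block through two earlier ones makes
-- the blocks of different edges different, a Berge-F.
--
-- Lower-regularity needs no energy increment: as long as irregular pairs of parts have a positive share
-- of the area, declare their sparse rectangles dead and refine the partition accordingly. The dead area grows by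
-- a fixed proportion of n² each time, and as a disjoint union of sparse rectangles it contains few edges.
open import Defs
open import Data.Nat using (ℕ; _≤_)

open import Data.Bool using (Bool; true; false; if_then_else_; T; _∧_; not)
open import Data.Bool.Properties using (T?; T-irrelevant; T-∧)
open import Data.Empty using (⊥; ⊥-elim)
open import Data.Fin as F using (Fin; zero; suc; _≟_; combine; remQuot; funToFin; finToFun; inject≤)
import Data.Fin.Properties as F
open import Data.Fin.Properties
  using (all?; any?; suc-injective; remQuot-combine; combine-remQuot; finToFun-funToFin; inject≤-injective)
open import Data.Fin.Subset using (Subset; inside; outside; _∈_; _⊆_; _∪_; ⁅_⁆; ∣_∣) renaming (⊥ to ∅)
open import Data.Fin.Subset.Properties using (_∈?_; anySubset?; ∉⊥; x∈p∪q⁻; x∈⁅y⁆⇒x≡y)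
open import Data.List using (List; []; _∷_; length)
open import Data.List.Membership.Propositional using (lose) renaming (_∈_ to _∈ₗ_; _∉_ to _∉ₗ_)
open import Data.List.Relation.Unary.Any as Any using (Any; here; there)
open import Data.Nat using (zero; suc; _+_; _*_; _^_; _<_; _≤?_; _<?_; z≤n; s≤s; NonZero; >-nonZero; >-nonZero⁻¹)
open import Data.Nat.Properties hiding (_≟_; suc-injective; _≤?_; _<?_)
open import Data.Product using (∃-syntax; _×_; _,_; proj₁; proj₂; map₂)
open import Data.Sum using (_⊎_; inj₁; inj₂; [_,_]′)
open import Data.Unit using (⊤; tt)
open import Data.Vec as Vec using ([]; _∷_; tabulate)
open import Data.Vec.Properties using (lookup∘tabulate; lookup⇒[]=; []=⇒lookup)
open import Function
  using (_∘_; id; case_of_; Equivalence; Injection; Injective; mk↣; mk⤖)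
open import Relation.Binary using (tri<; tri≈; tri>)
open import Relation.Binary.PropositionalEquality
open import Relation.Nullary using (¬_; Dec; yes; no; does; contradiction)
open import Relation.Nullary.Decidable using (_×-dec_; _⊎-dec_; _→-dec_; ¬?; dec-true)

open import Algebra.Properties.Semiring.Sum +-*-semiring
  using (sum; sum-cong-≗; ∑-distrib-+; ∑-comm; *-distribˡ-sum; *-distribʳ-sum)

private variable
  m n k : ℕ

-- Counting by sums of indicators, and grouping pairs by parts

𝟙 : {A : Set} → Dec A → ℕ
𝟙 a = if does a then 1 else 0

𝟙-yes : {A : Set} (a : Dec A) → A → 𝟙 a ≡ 1
𝟙-yes (yes _) _ = refl
𝟙-yes (no ¬p) p = contradiction p ¬p

𝟙-no : {A : Set} (a : Dec A) → ¬ A → 𝟙 a ≡ 0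
𝟙-no (yes p) ¬p = contradiction p ¬p
𝟙-no (no _)  _  = refl

𝟙≤1 : {A : Set} (a : Dec A) → 𝟙 a ≤ 1
𝟙≤1 (yes _) = ≤-refl
𝟙≤1 (no _)  = z≤n

𝟙-mono : {A B : Set} (a : Dec A) (b : Dec B) → (A → B) → 𝟙 a ≤ 𝟙 b
𝟙-mono (no _)  b f = z≤n
𝟙-mono (yes p) b f = ≤-reflexive (sym (𝟙-yes b (f p)))

𝟙-× : {A B : Set} (a : Dec A) (b : Dec B) → 𝟙 (a ×-dec b) ≡ 𝟙 a * 𝟙 b
𝟙-× (yes _) (yes _) = refl
𝟙-× (yes _) (no _)  = refl
𝟙-× (no _)  _       = refl

𝟙-disjoint : {A B C : Set} (a : Dec A) (b : Dec B) (c : Dec C) →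
             (A → C) → (B → C) → (A → B → ⊥) → 𝟙 a + 𝟙 b ≤ 𝟙 c
𝟙-disjoint (yes p) (yes q) c f g h = ⊥-elim (h p q)
𝟙-disjoint (yes p) (no _)  c f g h = ≤-reflexive (sym (𝟙-yes c (f p)))
𝟙-disjoint (no _)  b       c f g h = 𝟙-mono b c g

sum-mono : {f g : Fin n → ℕ} → (∀ i → f i ≤ g i) → sum f ≤ sum g
sum-mono {zero}  h = z≤n
sum-mono {suc n} h = +-mono-≤ (h zero) (sum-mono (h ∘ suc))

sum-const : ∀ n {k} → sum {n} (λ _ → k) ≡ n * k
sum-const zero        = refl
sum-const (suc n) {k} = cong (k +_) (sum-const n)

sum-≤-const : {f : Fin n → ℕ} → (∀ i → f i ≤ k) → sum f ≤ n * k
sum-≤-const {n} h = ≤-trans (sum-mono h) (≤-reflexive (sum-const n))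

term≤sum : (f : Fin n → ℕ) (i : Fin n) → f i ≤ sum f
term≤sum f zero    = m≤m+n _ _
term≤sum f (suc i) = ≤-trans (term≤sum (f ∘ suc) i) (m≤n+m _ _)

sum-𝟙-≟ : (a : Fin m) (v : ℕ) → sum (λ b → 𝟙 (a ≟ b) * v) ≡ v
sum-𝟙-≟ {suc m} zero v = begin
  v + 0 + sum {m} (λ _ → 0)  ≡⟨ cong (v + 0 +_) (trans (sum-const m) (*-zeroʳ m)) ⟩
  v + 0 + 0                  ≡⟨ +-identityʳ _ ⟩
  v + 0                      ≡⟨ +-identityʳ _ ⟩
  v                          ∎
  where open ≡-Reasoning
sum-𝟙-≟ (suc a) v = sum-𝟙-≟ a v

count : {P : Fin n → Set} → (∀ x → Dec (P x)) → ℕ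
count P? = sum (λ x → 𝟙 (P? x))

count₂ : {R : Fin m → Fin n → Set} → (∀ x y → Dec (R x y)) → ℕ
count₂ R? = sum (λ x → count (R? x))

module _ {P Q : Fin n → Set} (P? : ∀ x → Dec (P x)) (Q? : ∀ x → Dec (Q x)) where

  count-mono : (∀ x → P x → Q x) → count P? ≤ count Q?
  count-mono h = sum-mono (λ x → 𝟙-mono (P? x) (Q? x) (h x))

  count-excess : count Q? < count P? → ∃[ x ] (P x × ¬ Q x)
  count-excess lt with any? (λ x → P? x ×-dec ¬? (Q? x))
  ... | yes w = w
  ... | no ¬w = contradiction (count-mono P⊆Q) (<⇒≱ lt)
    where
    P⊆Q : ∀ x → P x → Q x
    P⊆Q x p with Q? x
    ... | yes q = q
    ... | no ¬q = contradiction (x , p , ¬q) ¬w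

module _ {P : Fin n → Set} (P? : ∀ x → Dec (P x)) where

  count-none : (∀ x → ¬ P x) → count P? ≡ 0
  count-none h = trans (sum-cong-≗ λ x → 𝟙-no (P? x) (h x)) (trans (sum-const n) (*-zeroʳ n))

  count≤n : count P? ≤ n
  count≤n = ≤-trans (sum-≤-const (λ x → 𝟙≤1 (P? x))) (≤-reflexive (*-identityʳ n))

  1≤count : ∀ x → P x → 1 ≤ count P?
  1≤count x p = ≤-trans (≤-reflexive (sym (𝟙-yes (P? x) p))) (term≤sum (λ x → 𝟙 (P? x)) x)

  count-unique : (∀ x y → P x → P y → x ≡ y) → count P? ≤ 1
  count-unique h with any? P?
  ... | no ¬w = ≤-trans (≤-reflexive (count-none λ x p → ¬w (x , p))) z≤n
  ... | yes (x , p) = begin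
    count P?                       ≤⟨ count-mono P? (x ≟_) (λ y q → h x y p q) ⟩
    count (x ≟_)                   ≡⟨ sum-cong-≗ (λ y → sym (*-identityʳ (𝟙 (x ≟ y)))) ⟩
    sum (λ y → 𝟙 (x ≟ y) * 1)      ≡⟨ sum-𝟙-≟ x 1 ⟩
    1                              ∎
    where open ≤-Reasoning

  count-⋃ : {Q : Fin m → Fin n → Set} (Q? : ∀ i x → Dec (Q i x)) →
            (∀ x → P x → ∃[ i ] Q i x) → count P? ≤ sum (λ i → count (Q? i))
  count-⋃ Q? h = ≤-trans (sum-mono pointwise) (≤-reflexive (∑-comm (λ x i → 𝟙 (Q? i x))))
    where
    pointwise : ∀ x → 𝟙 (P? x) ≤ sum (λ i → 𝟙 (Q? i x))
    pointwise x with P? x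
    ... | no _ = z≤n
    ... | yes p with i , q ← h x p =
      ≤-trans (≤-reflexive (sym (𝟙-yes (Q? i x) q))) (term≤sum (λ i → 𝟙 (Q? i x)) i)

  count-⊎ : {Q R : Fin n → Set} (Q? : ∀ x → Dec (Q x)) (R? : ∀ x → Dec (R x)) →
            (∀ x → P x → Q x ⊎ R x) → count P? ≤ count Q? + count R?
  count-⊎ Q? R? h = ≤-trans (sum-mono pointwise) (≤-reflexive (∑-distrib-+ (λ x → 𝟙 (Q? x)) (λ x → 𝟙 (R? x))))
    where
    pointwise : ∀ x → 𝟙 (P? x) ≤ 𝟙 (Q? x) + 𝟙 (R? x)
    pointwise x with P? x
    ... | no _ = z≤n
    ... | yes p with h x p
    ...   | inj₁ q = ≤-trans (≤-reflexive (sym (𝟙-yes (Q? x) q))) (m≤m+n _ _)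
    ...   | inj₂ r = ≤-trans (≤-reflexive (sym (𝟙-yes (R? x) r))) (m≤n+m _ _)

count-Any : {A : Set} {R : A → Fin n → Set} (R? : ∀ u x → Dec (R u x)) →
            (∀ u → count (R? u) ≤ k) → (L : List A) →
            count (λ x → Any.any? (λ u → R? u x) L) ≤ length L * k
count-Any {n = n} R? h [] = ≤-reflexive (count-none {n} (λ x → Any.any? (λ u → R? u x) []) λ _ ())
count-Any R? h (u ∷ L) = ≤-trans
  (count-⊎ (λ x → Any.any? (λ u → R? u x) (u ∷ L)) (R? u) (λ x → Any.any? (λ u → R? u x) L)
    λ { x (here r) → inj₁ r ; x (there a) → inj₂ a })
  (+-mono-≤ (h u) (count-Any R? h L))

module _ {P Q : Fin m → Fin n → Set} (P? : ∀ x y → Dec (P x y)) (Q? : ∀ x y → Dec (Q x y)) where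

  count₂-mono : (∀ x y → P x y → Q x y) → count₂ P? ≤ count₂ Q?
  count₂-mono h = sum-mono (λ x → count-mono (P? x) (Q? x) (h x))

module _ {P Q R : Fin m → Fin n → Set}
         (P? : ∀ x y → Dec (P x y)) (Q? : ∀ x y → Dec (Q x y)) (R? : ∀ x y → Dec (R x y)) where

  count₂-⊎ : (∀ x y → P x y → Q x y ⊎ R x y) → count₂ P? ≤ count₂ Q? + count₂ R?
  count₂-⊎ h = ≤-trans (sum-mono λ x → count-⊎ (P? x) (Q? x) (R? x) (h x))
    (≤-reflexive (∑-distrib-+ (λ x → count (Q? x)) (λ x → count (R? x))))

  count₂-disjoint : (∀ x y → P x y → R x y) → (∀ x y → Q x y → R x y) →
                    (∀ x y → P x y → Q x y → ⊥) → count₂ P? + count₂ Q? ≤ count₂ R?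
  count₂-disjoint f g h = ≤-trans
    (≤-reflexive (sym (∑-distrib-+ (λ x → count (P? x)) (λ x → count (Q? x)))))
    (sum-mono λ x → ≤-trans
      (≤-reflexive (sym (∑-distrib-+ (λ y → 𝟙 (P? x y)) (λ y → 𝟙 (Q? x y)))))
      (sum-mono λ y → 𝟙-disjoint (P? x y) (Q? x y) (R? x y) (f x y) (g x y) (h x y)))

count₂-none : {P : Fin m → Fin n → Set} (P? : ∀ x y → Dec (P x y)) → (∀ x y → ¬ P x y) → count₂ P? ≡ 0
count₂-none {m} P? h = trans (sum-cong-≗ λ x → count-none (P? x) (h x)) (trans (sum-const m) (*-zeroʳ m))

count₂-× : {P : Fin m → Set} {Q : Fin n → Set} (P? : ∀ x → Dec (P x)) (Q? : ∀ y → Dec (Q y)) →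
           count₂ (λ x y → P? x ×-dec Q? y) ≡ count P? * count Q?
count₂-× P? Q? = begin
  sum (λ x → sum (λ y → 𝟙 (P? x ×-dec Q? y)))    ≡⟨ sum-cong-≗ (λ x → sum-cong-≗ λ y → 𝟙-× (P? x) (Q? y)) ⟩
  sum (λ x → sum (λ y → 𝟙 (P? x) * 𝟙 (Q? y)))    ≡⟨ sum-cong-≗ (λ x → *-distribˡ-sum (𝟙 (P? x)) (λ y → 𝟙 (Q? y))) ⟨
  sum (λ x → 𝟙 (P? x) * count Q?)                ≡⟨ *-distribʳ-sum (count Q?) (λ x → 𝟙 (P? x)) ⟨
  count P? * count Q?                            ∎
  where open ≡-Reasoning

module Fibres (π : Fin n → Fin m) where

  sum-fibre : (f : Fin n → ℕ) → sum (λ a → sum (λ x → 𝟙 (π x ≟ a) * f x)) ≡ sum f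
  sum-fibre f = trans (∑-comm (λ a x → 𝟙 (π x ≟ a) * f x)) (sum-cong-≗ λ x → sum-𝟙-≟ (π x) (f x))

  fibre₂? : {R : Fin n → Fin n → Set} → (∀ x y → Dec (R x y)) →
            ∀ a b x y → Dec ((π x ≡ a × π y ≡ b) × R x y)
  fibre₂? R? a b x y = (π x ≟ a ×-dec π y ≟ b) ×-dec R? x y

  count₂-fibre : {R : Fin n → Fin n → Set} (R? : ∀ x y → Dec (R x y)) →
                 sum (λ a → sum (λ b → count₂ (fibre₂? R? a b))) ≡ count₂ R?
  count₂-fibre R? = begin
    sum (λ a → sum (λ b → sum (λ x → sum (λ y → 𝟙 (fibre₂? R? a b x y)))))
      ≡⟨ sum-cong-≗ (λ a → sum-cong-≗ λ b → sum-cong-≗ λ x → inner a b x) ⟩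
    sum (λ a → sum (λ b → sum (λ x → 𝟙 (π x ≟ a) * sum (λ y → 𝟙 (π y ≟ b) * 𝟙 (R? x y)))))
      ≡⟨ sum-cong-≗ (λ a → ∑-comm (λ b x → 𝟙 (π x ≟ a) * sum (λ y → 𝟙 (π y ≟ b) * 𝟙 (R? x y)))) ⟩
    sum (λ a → sum (λ x → sum (λ b → 𝟙 (π x ≟ a) * sum (λ y → 𝟙 (π y ≟ b) * 𝟙 (R? x y)))))
      ≡⟨ sum-cong-≗ (λ a → sum-cong-≗ λ x → *-distribˡ-sum (𝟙 (π x ≟ a)) (λ b → sum (λ y → 𝟙 (π y ≟ b) * 𝟙 (R? x y)))) ⟨
    sum (λ a → sum (λ x → 𝟙 (π x ≟ a) * sum (λ b → sum (λ y → 𝟙 (π y ≟ b) * 𝟙 (R? x y)))))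
      ≡⟨ sum-cong-≗ (λ a → sum-cong-≗ λ x → cong (𝟙 (π x ≟ a) *_) (sum-fibre (λ y → 𝟙 (R? x y)))) ⟩
    sum (λ a → sum (λ x → 𝟙 (π x ≟ a) * count (R? x)))
      ≡⟨ sum-fibre (λ x → count (R? x)) ⟩
    count₂ R? ∎
    where
    open ≡-Reasoning
    inner : ∀ a b x → sum (λ y → 𝟙 (fibre₂? R? a b x y)) ≡ 𝟙 (π x ≟ a) * sum (λ y → 𝟙 (π y ≟ b) * 𝟙 (R? x y))
    inner a b x = trans
      (sum-cong-≗ λ y → trans (𝟙-× (π x ≟ a ×-dec π y ≟ b) (R? x y))
        (trans (cong (_* 𝟙 (R? x y)) (𝟙-× (π x ≟ a) (π y ≟ b)))
          (*-assoc (𝟙 (π x ≟ a)) (𝟙 (π y ≟ b)) (𝟙 (R? x y)))))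
      (sym (*-distribˡ-sum (𝟙 (π x ≟ a)) (λ y → 𝟙 (π y ≟ b) * 𝟙 (R? x y))))

  -- The fibres over pairs of labels partition all pairs, so a comparison valid on every pair of
  -- parts adds up to a global one. Estimates for single rectangles become estimates for the whole
  -- square this way.
  fibrewise-≤ : {P Q : Fin n → Fin n → Set} (P? : ∀ x y → Dec (P x y)) (Q? : ∀ x y → Dec (Q x y)) (s t : ℕ) →
                (∀ a b → s * count₂ (fibre₂? P? a b) ≤ t * count₂ (fibre₂? Q? a b)) →
                s * count₂ P? ≤ t * count₂ Q?
  fibrewise-≤ P? Q? s t h = begin
    s * count₂ P?                                            ≡⟨ expand s P? ⟩
    sum (λ a → sum (λ b → s * count₂ (fibre₂? P? a b)))      ≤⟨ sum-mono (λ a → sum-mono (h a)) ⟩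
    sum (λ a → sum (λ b → t * count₂ (fibre₂? Q? a b)))      ≡⟨ expand t Q? ⟨
    t * count₂ Q?                                            ∎
    where
    open ≤-Reasoning
    expand : ∀ s {R : Fin n → Fin n → Set} (R? : ∀ x y → Dec (R x y)) →
             s * count₂ R? ≡ sum (λ a → sum (λ b → s * count₂ (fibre₂? R? a b)))
    expand s R? = trans (cong (s *_) (sym (count₂-fibre R?)))
      (trans (*-distribˡ-sum s (λ a → sum (λ b → count₂ (fibre₂? R? a b))))
        (sum-cong-≗ λ a → *-distribˡ-sum s (λ b → count₂ (fibre₂? R? a b))))

-- Lower-regular partitions

card : Subset n → ℕ
card S = count (_∈? S)

part : (Fin n → Fin m) → Fin m → ℕ
part π a = count (λ x → π x ≟ a)

-- The new label of x records its part and which of the sets S (π x) b and R a (π x) contain it.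
module Refinement {n M} (π : Fin n → Fin M) (live : Fin M → Fin M → Bool)
                  (S R : Fin M → Fin M → Subset n) where

  private
    bit : Bool → Fin 2
    bit b = if b then suc zero else zero

    unbit : Fin 2 → Bool
    unbit zero    = false
    unbit (suc _) = true

    unbit-bit : ∀ b → unbit (bit b) ≡ b
    unbit-bit true  = refl
    unbit-bit false = refl

    sBits rBits : Fin n → Fin M → Fin 2
    sBits x b = bit (does (x ∈? S (π x) b))
    rBits x a = bit (does (x ∈? R a (π x)))

  labels : ℕ
  labels = M * (2 ^ M * 2 ^ M)

  label : Fin n → Fin labels
  label x = combine (π x) (combine (funToFin (sBits x)) (funToFin (rBits x)))

  private
    decode : Fin labels → Fin M × Fin (2 ^ M) × Fin (2 ^ M)
    decode u = map₂ (remQuot (2 ^ M)) (remQuot {M} (2 ^ M * 2 ^ M) u)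

    decode-label : ∀ x → decode (label x) ≡ (π x , funToFin (sBits x) , funToFin (rBits x))
    decode-label x = trans
      (cong (map₂ (remQuot (2 ^ M))) (remQuot-combine (π x) _))
      (cong (π x ,_) (remQuot-combine (funToFin (sBits x)) (funToFin (rBits x))))

    -- The first vertex supplies its `S`-bit at the part of the second, the second its `R`-bit at
    -- the part of the first. So the two labels alone decide whether a pair lies in the rectangle of
    -- its parts.
    survives : (u v : Fin M × Fin (2 ^ M) × Fin (2 ^ M)) → Bool
    survives (a , s , _) (b , _ , r) = live a b ∧ not (unbit (finToFun s b) ∧ unbit (finToFun r a))

  live′ : Fin labels → Fin labels → Bool
  live′ u v = survives (decode u) (decode v)

  live′-label : ∀ x y → live′ (label x) (label y) ≡
    live (π x) (π y) ∧ not (does (x ∈? S (π x) (π y)) ∧ does (y ∈? R (π x) (π y)))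
  live′-label x y = trans (cong₂ survives (decode-label x) (decode-label y))
    (cong₂ (λ s r → live (π x) (π y) ∧ not (s ∧ r))
      (trans (cong unbit (finToFun-funToFin (sBits x) (π y))) (unbit-bit _))
      (trans (cong unbit (finToFun-funToFin (rBits y) (π x))) (unbit-bit _)))

  live′⇒ : ∀ x y → T (live′ (label x) (label y)) →
           T (live (π x) (π y)) × ¬ (x ∈ S (π x) (π y) × y ∈ R (π x) (π y))
  live′⇒ x y t rewrite live′-label x y
    with live (π x) (π y) | x ∈? S (π x) (π y) | y ∈? R (π x) (π y)
  ... | true | yes _ | no ¬r = tt , λ (_ , r) → ¬r r
  ... | true | no ¬s | _     = tt , λ (s , _) → ¬s s

  live′⇐ : ∀ x y → T (live (π x) (π y)) → ¬ (x ∈ S (π x) (π y) × y ∈ R (π x) (π y)) →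
           T (live′ (label x) (label y))
  live′⇐ x y l ¬sr rewrite live′-label x y
    with live (π x) (π y) | x ∈? S (π x) (π y) | y ∈? R (π x) (π y)
  ... | true | yes s | yes r = ¬sr (s , r)
  ... | true | yes _ | no _  = tt
  ... | true | no _  | _     = tt

-- Densities are compared with 1 / q, relative sizes of subsets of a part with 1 / d.
module Regularity {n} {Adj : Fin n → Fin n → Set} (Adj? : ∀ x y → Dec (Adj x y)) (q d : ℕ) where

  edgesBetween? : ∀ (S R : Subset n) x y → Dec ((x ∈ S × y ∈ R) × Adj x y)
  edgesBetween? S R x y = (x ∈? S ×-dec y ∈? R) ×-dec Adj? x y

  edgesBetween : Subset n → Subset n → ℕ
  edgesBetween S R = count₂ (edgesBetween? S R)

  module _ {M} (π : Fin n → Fin M) where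

    -- Regularity is only violated from below: unusually dense pairs are harmless. The strict
    -- inequality forces `S` and `R` to be nonempty; `a` and `b` may coincide.
    Sparse : Fin M → Fin M → Subset n → Subset n → Set
    Sparse a b S R = (∀ x → x ∈ S → π x ≡ a) × (∀ y → y ∈ R → π y ≡ b)
      × part π a ≤ d * card S × part π b ≤ d * card R × q * edgesBetween S R < card S * card R

    Sparse? : ∀ a b S R → Dec (Sparse a b S R)
    Sparse? a b S R = all? (λ x → x ∈? S →-dec π x ≟ a) ×-dec all? (λ x → x ∈? R →-dec π x ≟ b)
      ×-dec part π a ≤? d * card S ×-dec part π b ≤? d * card R ×-dec q * edgesBetween S R <? card S * card R

    Irregular : Fin M → Fin M → Set
    Irregular a b = ∃[ S ] ∃[ R ] Sparse a b S R

    Irregular? : ∀ a b → Dec (Irregular a b)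
    Irregular? a b = anySubset? λ S → anySubset? λ R → Sparse? a b S R

  module _ {M} (π : Fin n → Fin M) (live : Fin M → Fin M → Bool) where

    Live : Fin n → Fin n → Set
    Live x y = T (live (π x) (π y))

    Live? : ∀ x y → Dec (Live x y)
    Live? x y = T? (live (π x) (π y))

    dead-edge? : ∀ x y → Dec (Adj x y × ¬ Live x y)
    dead-edge? x y = Adj? x y ×-dec ¬? (Live? x y)

    irregular? : ∀ x y → Dec (Live x y × Irregular π (π x) (π y))
    irregular? x y = Live? x y ×-dec Irregular? π (π x) (π y)

  -- Irregularity is measured in vertex pairs rather than in pairs of parts, because the parts may
  -- have very different sizes.
  record RegularPartition (E B : ℕ) : Set where
    field
      M      : ℕ
      M≤B    : M ≤ B
      π      : Fin n → Fin M
      live   : Fin M → Fin M → Bool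
      few-dead-edges : q * count₂ (dead-edge? π live) ≤ n * n
      few-irregular  : E * count₂ (irregular? π live) ≤ n * n

  module Step {M} (π : Fin n → Fin M) (live : Fin M → Fin M → Bool) where

    -- The empty default gives a pair of parts without defect an empty rectangle, so that the
    -- estimates below hold uniformly for all pairs of parts.
    witness : ∀ a b → Dec (T (live a b) × Irregular π a b) → Subset n × Subset n
    witness a b (yes (_ , S , R , _)) = S , R
    witness a b (no _)                = ∅ , ∅

    defect? : ∀ a b → Dec (T (live a b) × Irregular π a b)
    defect? a b = T? (live a b) ×-dec Irregular? π a b

    S R : Fin M → Fin M → Subset n
    S a b = proj₁ (witness a b (defect? a b))
    R a b = proj₂ (witness a b (defect? a b))

    open Refinement π live S R public
    open Fibres π

    Killed : Fin n → Fin n → Set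
    Killed x y = x ∈ S (π x) (π y) × y ∈ R (π x) (π y)

    Killed? : ∀ x y → Dec (Killed x y)
    Killed? x y = x ∈? S (π x) (π y) ×-dec y ∈? R (π x) (π y)

    killed-edge? : ∀ x y → Dec (Killed x y × Adj x y)
    killed-edge? x y = Killed? x y ×-dec Adj? x y

    witness-live : ∀ a b (w : Dec (T (live a b) × Irregular π a b)) x →
                   x ∈ proj₁ (witness a b w) → T (live a b)
    witness-live a b (yes (l , _)) x _  = l
    witness-live a b (no _)        x x∈ = contradiction x∈ ∉⊥

    -- For a fixed pair of parts, the killed pairs form the rectangle S × R.
    module _ (a b : Fin M) where

      rect? : ∀ x y → Dec (x ∈ S a b × y ∈ R a b)
      rect? x y = x ∈? S a b ×-dec y ∈? R a b

      private
        to-rect : ∀ {x y} → π x ≡ a → π y ≡ b → Killed x y → x ∈ S a b × y ∈ R a b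
        to-rect refl refl k = k

        sparse : q * edgesBetween (S a b) (R a b) ≤ card (S a b) * card (R a b)
        sparse with defect? a b
        ... | yes (_ , _ , _ , _ , _ , _ , _ , sp) = <⇒≤ sp
        ... | no _ = ≤-reflexive (trans
            (cong (q *_) (count₂-none (edgesBetween? ∅ ∅) λ x y ((x∈ , _) , _) → ∉⊥ x∈))
            (trans (*-zeroʳ q) (cong (_* card {n} ∅) (sym (count-none {n} (_∈? ∅) λ x → ∉⊥)))))

        in-parts : ∀ x y → x ∈ S a b × y ∈ R a b → π x ≡ a × π y ≡ b
        in-parts x y (x∈ , y∈) with defect? a b
        ... | yes (_ , _ , _ , S⊆ , R⊆ , _) = S⊆ x x∈ , R⊆ y y∈
        ... | no _ = contradiction x∈ ∉⊥

        rect⇒killed : ∀ x y → x ∈ S a b × y ∈ R a b → (π x ≡ a × π y ≡ b) × Killed x y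
        rect⇒killed x y xy with in-parts x y xy
        ... | refl , refl = (refl , refl) , xy

      card-rect : card (S a b) * card (R a b) ≤ count₂ (fibre₂? Killed? a b)
      card-rect = ≤-trans (≤-reflexive (sym (count₂-× (_∈? S a b) (_∈? R a b))))
        (count₂-mono rect? (fibre₂? Killed? a b) rect⇒killed)

      sparse-fibre : q * count₂ (fibre₂? killed-edge? a b) ≤ 1 * count₂ (fibre₂? Killed? a b)
      sparse-fibre = begin
        q * count₂ (fibre₂? killed-edge? a b)
          ≤⟨ *-monoʳ-≤ q (count₂-mono (fibre₂? killed-edge? a b) (edgesBetween? (S a b) (R a b))
               λ { x y ((p , r) , k , adj) → to-rect p r k , adj }) ⟩
        q * edgesBetween (S a b) (R a b)  ≤⟨ sparse ⟩
        card (S a b) * card (R a b)       ≤⟨ card-rect ⟩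
        count₂ (fibre₂? Killed? a b)      ≡⟨ *-identityˡ _ ⟨
        1 * count₂ (fibre₂? Killed? a b)  ∎
        where open ≤-Reasoning

      -- `S` and `R` fill at least 1 / `d` of their parts, so the rectangle fills at least 1 / `d`²
      -- of a defective pair of parts; the other pairs of parts contribute nothing on the left.
      large-fibre : 1 * count₂ (fibre₂? (irregular? π live) a b) ≤ d * d * count₂ (fibre₂? Killed? a b)
      large-fibre = ≤-trans (≤-reflexive (*-identityˡ _)) (≤-trans large (*-monoʳ-≤ (d * d) card-rect))
        where
        large : count₂ (fibre₂? (irregular? π live) a b) ≤ d * d * (card (S a b) * card (R a b))
        large with defect? a b
        ... | yes (_ , S , R , _ , _ , A≤ , B≤ , _) = begin
          count₂ (fibre₂? (irregular? π live) a b)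
            ≤⟨ count₂-mono (fibre₂? (irregular? π live) a b) (λ x y → π x ≟ a ×-dec π y ≟ b) (λ _ _ → proj₁) ⟩
          count₂ (λ x y → π x ≟ a ×-dec π y ≟ b)    ≡⟨ count₂-× (λ x → π x ≟ a) (λ y → π y ≟ b) ⟩
          part π a * part π b                       ≤⟨ *-mono-≤ A≤ B≤ ⟩
          d * card S * (d * card R)                 ≡⟨ [m*n]*[o*p]≡[m*o]*[n*p] d (card S) d (card R) ⟩
          d * d * (card S * card R)                 ∎
          where open ≤-Reasoning
        ... | no ¬defect = ≤-trans (≤-reflexive (count₂-none (fibre₂? (irregular? π live) a b)
            λ { x y ((refl , refl) , di) → ¬defect di })) z≤n

    sparse-killed : q * count₂ killed-edge? ≤ count₂ Killed?
    sparse-killed = ≤-trans (fibrewise-≤ killed-edge? Killed? q 1 sparse-fibre) (≤-reflexive (*-identityˡ _))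

    irregular≤killed : count₂ (irregular? π live) ≤ d * d * count₂ Killed?
    irregular≤killed = ≤-trans (≤-reflexive (sym (*-identityˡ _)))
      (fibrewise-≤ (irregular? π live) Killed? 1 (d * d) large-fibre)

    live-area : count₂ Killed? + count₂ (Live? label live′) ≤ count₂ (Live? π live)
    live-area = count₂-disjoint Killed? (Live? label live′) (Live? π live)
      (λ x y (x∈ , _) → witness-live (π x) (π y) (defect? (π x) (π y)) x x∈)
      (λ x y l → proj₁ (live′⇒ x y l))
      (λ x y k l → proj₂ (live′⇒ x y l) k)

    dead-edges : count₂ (dead-edge? label live′) ≤ count₂ (dead-edge? π live) + count₂ killed-edge?
    dead-edges = count₂-⊎ (dead-edge? label live′) (dead-edge? π live) killed-edge? cases
      where
      cases : ∀ x y → Adj x y × ¬ Live label live′ x y → (Adj x y × ¬ Live π live x y) ⊎ (Killed x y × Adj x y)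
      cases x y (adj , ¬l) with Killed? x y
      ... | yes k = inj₂ (k , adj)
      ... | no ¬k = inj₁ (adj , λ l → ¬l (live′⇐ x y l ¬k))

    -- Each dead edge is charged `q` units of dead area. Being sparse, the killed rectangles add at
    -- most as much charge as the area they move from live to dead.
    invariant : q * count₂ (dead-edge? π live) + count₂ (Live? π live) ≤ n * n →
                q * count₂ (dead-edge? label live′) + count₂ (Live? label live′) ≤ n * n
    invariant inv = begin
      q * count₂ (dead-edge? label live′) + L′     ≤⟨ +-monoˡ-≤ L′ (*-monoʳ-≤ q dead-edges) ⟩
      q * (D + count₂ killed-edge?) + L′           ≡⟨ cong (_+ L′) (*-distribˡ-+ q D _) ⟩
      q * D + q * count₂ killed-edge? + L′         ≤⟨ +-monoˡ-≤ L′ (+-monoʳ-≤ (q * D) sparse-killed) ⟩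
      q * D + count₂ Killed? + L′                  ≡⟨ +-assoc (q * D) _ L′ ⟩
      q * D + (count₂ Killed? + L′)                ≤⟨ +-monoʳ-≤ (q * D) live-area ⟩
      q * D + count₂ (Live? π live)                ≤⟨ inv ⟩
      n * n                                        ∎
      where
      open ≤-Reasoning
      L′ = count₂ (Live? label live′)
      D  = count₂ (dead-edge? π live)

    -- Irregular area above n² / `E` gives killed area above n² / (`E` `d`²). Multiplied out, the
    -- potential `E * (d * d) * count₂ Live?` drops by more than n².
    progress : ∀ E → n * n < E * count₂ (irregular? π live) →
               n * n + E * (d * d) * count₂ (Live? label live′) < E * (d * d) * count₂ (Live? π live)
    progress E lt = begin-strict
      n * n + κ * L′                           <⟨ +-monoˡ-< (κ * L′) lt ⟩
      E * count₂ (irregular? π live) + κ * L′  ≤⟨ +-monoˡ-≤ (κ * L′) (*-monoʳ-≤ E irregular≤killed) ⟩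
      E * (d * d * count₂ Killed?) + κ * L′    ≡⟨ cong (_+ κ * L′) (*-assoc E (d * d) _) ⟨
      κ * count₂ Killed? + κ * L′              ≡⟨ *-distribˡ-+ κ _ L′ ⟨
      κ * (count₂ Killed? + L′)                ≤⟨ *-monoʳ-≤ κ live-area ⟩
      κ * count₂ (Live? π live)                ∎
      where
      open ≤-Reasoning
      κ  = E * (d * d)
      L′ = count₂ (Live? label live′)

-- Each refinement step turns `M` labels into `M` · 4^`M`. Adding `M` in every round keeps the bound
-- valid when the iteration stops early.
partBound : ℕ → ℕ → ℕ
partBound zero       M = M
partBound (suc fuel) M = M + partBound fuel (M * (2 ^ M * 2 ^ M))

module _ {n} {Adj : Fin n → Fin n → Set} (Adj? : ∀ x y → Dec (Adj x y)) (q d : ℕ) where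

  open Regularity Adj? q d

  -- `fuel` bounds the potential in units of n², and by `progress` every refinement step takes off
  -- at least one unit.
  regularise : ∀ E fuel {M} (π : Fin n → Fin M) (live : Fin M → Fin M → Bool) →
    q * count₂ (dead-edge? π live) + count₂ (Live? π live) ≤ n * n →
    E * (d * d) * count₂ (Live? π live) ≤ fuel * (n * n) →
    RegularPartition E (partBound fuel M)
  regularise E fuel {M} π live inv small with E * count₂ (irregular? π live) ≤? n * n
  ... | yes few = record
    { M = M ; M≤B = M≤ fuel ; π = π ; live = live
    ; few-dead-edges = ≤-trans (m≤m+n _ _) inv ; few-irregular = few }
    where
    M≤ : ∀ fuel → M ≤ partBound fuel M
    M≤ zero       = ≤-refl
    M≤ (suc fuel) = m≤m+n M _
  regularise E zero π live inv small | no many =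
    -- Without fuel the potential is zero and cannot drop any further.
    contradiction (≤-trans (Step.progress π live E (≰⇒> many)) small) λ ()
  regularise E (suc fuel) {M} π live inv small | no many =
    record { M = M₁ ; M≤B = ≤-trans M≤B (m≤n+m _ M) ; π = π₁ ; live = live₁
           ; few-dead-edges = few-dead-edges ; few-irregular = few-irregular }
    where
    open Step π live
    open RegularPartition (regularise E fuel label live′ (invariant inv)
      (+-cancelˡ-≤ (n * n) _ _ (≤-trans (<⇒≤ (progress E (≰⇒> many))) small)))
      renaming (M to M₁; π to π₁; live to live₁)

  -- The start is a single part with everything live: no edge is dead and the live area is at most
  -- n², so `E * (d * d)` units of fuel suffice. The resulting bound on the number of parts does not
  -- depend on `n`.
  regularity : ∀ E → RegularPartition E (partBound (E * (d * d)) 1)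
  regularity E = regularise E (E * (d * d)) π₀ (λ _ _ → true)
    (begin
      q * count₂ (dead-edge? π₀ (λ _ _ → true)) + L
        ≡⟨ cong (λ z → q * z + L) (count₂-none (dead-edge? π₀ (λ _ _ → true)) λ x y (_ , ¬l) → ¬l tt) ⟩
      q * 0 + L   ≡⟨ cong (_+ L) (*-zeroʳ q) ⟩
      L           ≤⟨ L≤ ⟩
      n * n       ∎)
    (*-monoʳ-≤ (E * (d * d)) L≤)
    where
    open ≤-Reasoning
    π₀ : Fin n → Fin 1
    π₀ _ = zero
    L = count₂ (Live? π₀ (λ _ _ → true))
    L≤ : L ≤ n * n
    L≤ = sum-≤-const (λ x → count≤n (Live? π₀ (λ _ _ → true) x))

-- Greedy embedding into lower-regular parts

module _ {n} {P : Fin n → Set} (P? : ∀ x → Dec (P x)) where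

  ⟨_⟩ : Subset n
  ⟨_⟩ = tabulate (does ∘ P?)

  ∈⟨⟩⁺ : ∀ {x} → P x → x ∈ ⟨_⟩
  ∈⟨⟩⁺ {x} p = lookup⇒[]= x _ (trans (lookup∘tabulate _ x) (dec-true (P? x) p))

  ∈⟨⟩⁻ : ∀ {x} → x ∈ ⟨_⟩ → P x
  ∈⟨⟩⁻ {x} x∈ with P? x | trans (sym (lookup∘tabulate (does ∘ P?) x)) ([]=⇒lookup x∈)
  ... | yes p | _ = p

  count≤card : count P? ≤ card ⟨_⟩
  count≤card = count-mono P? (_∈? ⟨_⟩) λ _ → ∈⟨⟩⁺

module Embedding {n} {Adj : Fin n → Fin n → Set} (Adj? : ∀ x y → Dec (Adj x y))
  (q d Q p β : ℕ) (0<q : 0 < q) (Qp<d : Q * p < d)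
  {c} (A : Fin c → Fin n → Set) (s : Fin c → ℕ) (large : ∀ i → d * β * Q < s i)
  (regular : ∀ i j → i ≢ j → ∀ S R → (∀ x → x ∈ S → A i x) → (∀ y → y ∈ R → A j y) →
             s i ≤ d * card S → s j ≤ d * card R → card S * card R ≤ q * Regularity.edgesBetween Adj? q d S R)
  (Forbidden : List (Fin n) → Fin n → Set) (forbidden? : ∀ L x → Dec (Forbidden L x))
  (few-forbidden : ∀ L → length L ≤ p → count (forbidden? L) ≤ β)
  where

  open Regularity Adj? q d using (edgesBetween; edgesBetween?)

  nbr? : ∀ (S : Subset n) x y → Dec (y ∈ S × Adj x y)
  nbr? S x y = y ∈? S ×-dec Adj? x y

  deg : Fin n → Subset n → ℕ
  deg x S = count (nbr? S x)

  low? : ∀ (S R : Subset n) x → Dec (x ∈ S × q * deg x R < card R)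
  low? S R x = x ∈? S ×-dec q * deg x R <? card R

  -- The vertices of low degree into R span a sparse pair with R, so there are few of them.
  few-low : ∀ i j → i ≢ j → ∀ S R → (∀ x → x ∈ S → A i x) → (∀ y → y ∈ R → A j y) →
            s j ≤ d * card R → d * count (low? S R) ≤ s i
  few-low i j i≢j S R S⊆ R⊆ R-large with d * count (low? S R) ≤? s i
  ... | yes few = few
  ... | no many = contradiction (large i) (≤⇒≯ (≤-trans s≤0 z≤n))
    where
    open ≤-Reasoning
    W = ⟨ low? S R ⟩
    W-large : s i ≤ d * card W
    W-large = ≤-trans (<⇒≤ (≰⇒> many)) (*-monoʳ-≤ d (count≤card (low? S R)))
    at? = edgesBetween? W R
    -- The strict inequality defining low degree saves one unit per vertex of `W`. Summed up,
    -- `card W` is left to spare, whereas regularity of `W` and `R` leaves no room, so `W` is empty.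
    pointwise : ∀ x → q * count (at? x) + 𝟙 (x ∈? W) ≤ 𝟙 (x ∈? W) * card R
    pointwise x = case x ∈? W of λ where
      (no x∉) → begin
        q * count (at? x) + 𝟙 (x ∈? W)
          ≡⟨ cong₂ (λ a b → q * a + b) (count-none (at? x) λ y ((x∈ , _) , _) → x∉ x∈) (𝟙-no (x ∈? W) x∉) ⟩
        q * 0 + 0                  ≡⟨ trans (+-identityʳ _) (*-zeroʳ q) ⟩
        0                          ≤⟨ z≤n ⟩
        𝟙 (x ∈? W) * card R        ∎
      (yes x∈) → begin
        q * count (at? x) + 𝟙 (x ∈? W)
          ≡⟨ cong (q * count (at? x) +_) (𝟙-yes (x ∈? W) x∈) ⟩
        q * count (at? x) + 1
          ≤⟨ +-monoˡ-≤ 1 (*-monoʳ-≤ q (count-mono (at? x) (nbr? R x) λ y ((_ , y∈) , a) → y∈ , a)) ⟩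
        q * deg x R + 1            ≡⟨ +-comm _ 1 ⟩
        suc (q * deg x R)          ≤⟨ proj₂ (∈⟨⟩⁻ (low? S R) x∈) ⟩
        card R                     ≡⟨ *-identityˡ _ ⟨
        1 * card R                 ≡⟨ cong (_* card R) (𝟙-yes (x ∈? W) x∈) ⟨
        𝟙 (x ∈? W) * card R        ∎
    few-edges : q * edgesBetween W R + card W ≤ card W * card R
    few-edges = begin
      q * edgesBetween W R + card W                    ≡⟨ cong (_+ card W) (*-distribˡ-sum q (λ x → count (at? x))) ⟩
      sum (λ x → q * count (at? x)) + card W           ≡⟨ ∑-distrib-+ (λ x → q * count (at? x)) (λ x → 𝟙 (x ∈? W)) ⟨
      sum (λ x → q * count (at? x) + 𝟙 (x ∈? W))       ≤⟨ sum-mono pointwise ⟩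
      sum (λ x → 𝟙 (x ∈? W) * card R)                  ≡⟨ *-distribʳ-sum (card R) (λ x → 𝟙 (x ∈? W)) ⟨
      card W * card R                                  ∎
    W-empty : card W ≤ 0
    W-empty = +-cancelˡ-≤ (q * edgesBetween W R) _ _ (begin
      q * edgesBetween W R + card W  ≤⟨ few-edges ⟩
      card W * card R
        ≤⟨ regular i j i≢j W R (λ x x∈ → S⊆ x (proj₁ (∈⟨⟩⁻ (low? S R) x∈))) R⊆ W-large R-large ⟩
      q * edgesBetween W R           ≡⟨ +-identityʳ _ ⟨
      q * edgesBetween W R + 0       ∎)
    s≤0 : s i ≤ 0
    s≤0 = ≤-trans W-large (≤-trans (*-monoʳ-≤ d W-empty) (≤-reflexive (*-zeroʳ d)))

  module _ {k} (i : Fin c) (S : Subset n) (S⊆ : ∀ x → x ∈ S → A i x) (Δ : ℕ) (S-large : s i ≤ Δ * card S)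
    (Δ≤Q : Δ ≤ Q) (k<p : k < p) (L : List (Fin n)) (L≤p : length L ≤ p)
    (F : Fin k → Set) (F? : ∀ w → Dec (F w)) (col : Fin k → Fin c) (i≢ : ∀ w → F w → i ≢ col w)
    (R : Fin k → Subset n) (R⊆ : ∀ w x → x ∈ R w → A (col w) x) (R-large : ∀ w → s (col w) ≤ Δ * card (R w))
    where

    private
      Bad : Fin k → Fin n → Set
      Bad w x = F w × x ∈ S × q * deg x (R w) < card (R w)

      bad? : ∀ w x → Dec (Bad w x)
      bad? w x = F? w ×-dec low? S (R w) x

      Δk<d : suc (k * Δ) ≤ d
      Δk<d = <-≤-trans (s≤s (≤-trans (*-mono-≤ (<⇒≤ k<p) Δ≤Q) (≤-reflexive (*-comm p Q)))) Qp<d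

      Δ≤d : Δ ≤ d
      Δ≤d = <⇒≤ (≤-<-trans (≤-trans Δ≤Q (m≤m*n Q p ⦃ >-nonZero (≤-<-trans z≤n k<p) ⦄)) Qp<d)

      few-bad : ∀ w → d * count (bad? w) ≤ s i
      few-bad w with F? w
      ... | yes f = few-low i (col w) (i≢ w f) S (R w) S⊆ (R⊆ w) (≤-trans (R-large w) (*-monoˡ-≤ _ Δ≤d))
      ... | no ¬f = ≤-trans (≤-reflexive (trans (cong (d *_) (trans (sum-const n) (*-zeroʳ n))) (*-zeroʳ d))) z≤n

    -- At most `β` vertices are forbidden, and each of the `k` later sets `R w` excludes at most
    -- `s i` / `d`, hence at most `Δ` |`S`| / `d`, vertices of `S`. As `k * Δ < d`, at least |`S`| /
    -- `d` vertices escape the latter, and this exceeds `β` by `large`.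
    good-vertex : ∃[ x ] (x ∈ S × ¬ Forbidden L x × (∀ w → F w → card (R w) ≤ q * deg x (R w)))
    good-vertex with any? (λ x → x ∈? S ×-dec ¬? (forbidden? L x)
                                 ×-dec all? (λ w → F? w →-dec card (R w) ≤? q * deg x (R w)))
    ... | yes w = w
    ... | no none = contradiction (large i) (≤⇒≯ (begin
      s i            ≤⟨ S-large ⟩
      Δ * card S     ≤⟨ *-mono-≤ Δ≤Q S-small ⟩
      Q * (d * β)    ≡⟨ *-comm Q _ ⟩
      d * β * Q      ∎))
      where
      open ≤-Reasoning
      cover : ∀ x → x ∈ S → Forbidden L x ⊎ (∃[ w ] Bad w x)
      cover x x∈ with forbidden? L x | any? (λ w → bad? w x)
      ... | yes f | _     = inj₁ f
      ... | no _  | yes b = inj₂ b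
      ... | no ¬f | no ¬b = contradiction
        (x , x∈ , ¬f , λ w f → ≮⇒≥ λ lt → ¬b (w , f , x∈ , lt)) none
      bad-sum : d * sum (λ w → count (bad? w)) ≤ k * s i
      bad-sum = ≤-trans (≤-reflexive (*-distribˡ-sum d (λ w → count (bad? w)))) (sum-≤-const few-bad)
      -- The `k * Δ` copies of `card S` pay for the vertices of low degree; once they are cancelled
      -- only the forbidden vertices remain.
      S-small : card S ≤ d * β
      S-small = +-cancelʳ-≤ (k * Δ * card S) _ _ (begin
        card S + k * Δ * card S                        ≡⟨⟩
        suc (k * Δ) * card S                           ≤⟨ *-monoˡ-≤ (card S) Δk<d ⟩
        d * card S
          ≤⟨ *-monoʳ-≤ d (count-⊎ (_∈? S) (forbidden? L) (λ x → any? (λ w → bad? w x)) cover) ⟩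
        d * (count (forbidden? L) + count (λ x → any? (λ w → bad? w x)))
          ≤⟨ *-monoʳ-≤ d (+-mono-≤ (few-forbidden L L≤p) (count-⋃ (λ x → any? (λ w → bad? w x)) bad? λ _ → id)) ⟩
        d * (β + sum (λ w → count (bad? w)))           ≡⟨ *-distribˡ-+ d β _ ⟩
        d * β + d * sum (λ w → count (bad? w))         ≤⟨ +-monoʳ-≤ (d * β) bad-sum ⟩
        d * β + k * s i                                ≤⟨ +-monoʳ-≤ (d * β) (*-monoʳ-≤ k S-large) ⟩
        d * β + k * (Δ * card S)                       ≡⟨ cong (d * β +_) (*-assoc k Δ (card S)) ⟨
        d * β + k * Δ * card S                         ∎)

  -- In `φ-new` the list `L′` stands for the vertices already used when `φ w` is chosen: those of
  -- `L` and the images of smaller vertices. Adjacency is stated from smaller to larger vertices, as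
  -- `Edge` lists its endpoints.
  record Copy {k} (F : Fin k → Fin k → Set) (C : Fin k → Subset n) (L : List (Fin n)) : Set where
    field
      φ     : Fin k → Fin n
      φ-∈   : ∀ v → φ v ∈ C v
      φ-adj : ∀ u v → u F.< v → F u v → Adj (φ u) (φ v)
      φ-new : ∀ w → ∃[ L′ ] (¬ Forbidden L′ (φ w) × (∀ {x} → x ∈ₗ L → x ∈ₗ L′) × (∀ u → u F.< w → φ u ∈ₗ L′))

  -- Each set of candidates keeps a proportion of at least 1 / Δ of its part; a step multiplies Δ by q.
  embed : ∀ k {F : Fin k → Fin k → Set} (F? : ∀ u v → Dec (F u v))
    (col : Fin k → Fin c) (proper : ∀ u v → F u v → col u ≢ col v)
    (C : Fin k → Subset n) (C⊆ : ∀ v x → x ∈ C v → A (col v) x)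
    (Δ : ℕ) (C-large : ∀ v → s (col v) ≤ Δ * card (C v)) (Δ-small : Δ * q ^ k ≤ Q)
    (L : List (Fin n)) (L-short : length L + k ≤ p) →
    Copy F C L
  embed zero F? col proper C C⊆ Δ C-large Δ-small L L-short =
    record { φ = λ () ; φ-∈ = λ () ; φ-adj = λ () ; φ-new = λ () }
  embed (suc k) {F} F? col proper C C⊆ Δ C-large Δ-small L L-short =
    record { φ = φ₀ ; φ-∈ = φ₀∈ ; φ-adj = φ₀-adj ; φ-new = φ₀-new }
    where
    Δ≤Q : Δ ≤ Q
    Δ≤Q = ≤-trans (m≤m*n Δ (q ^ suc k) ⦃ m^n≢0 q (suc k) ⦃ >-nonZero 0<q ⦄ ⦄) Δ-small

    k<p : k < p
    k<p = ≤-trans (m≤n+m (suc k) (length L)) L-short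

    good = good-vertex (col zero) (C zero) (C⊆ zero) Δ (C-large zero) Δ≤Q k<p L
      (≤-trans (m≤m+n _ _) L-short) (λ w → F zero (suc w)) (λ w → F? zero (suc w)) (col ∘ suc)
      (λ w → proper zero (suc w)) (C ∘ suc) (C⊆ ∘ suc) (C-large ∘ suc)

    x₀ : Fin n
    x₀ = proj₁ good

    restrict : ∀ w → Dec (F zero (suc w)) → Subset n
    restrict w (yes _) = ⟨ nbr? (C (suc w)) x₀ ⟩
    restrict w (no _)  = C (suc w)

    restrict-⊆ : ∀ w f x → x ∈ restrict w f → x ∈ C (suc w)
    restrict-⊆ w (yes _) x x∈ = proj₁ (∈⟨⟩⁻ (nbr? (C (suc w)) x₀) x∈)
    restrict-⊆ w (no _)  x x∈ = x∈

    restrict-adj : ∀ w f x → x ∈ restrict w f → F zero (suc w) → Adj x₀ x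
    restrict-adj w (yes _) x x∈ _ = proj₂ (∈⟨⟩⁻ (nbr? (C (suc w)) x₀) x∈)
    restrict-adj w (no ¬f) x _  f = contradiction f ¬f

    restrict-large : ∀ w f → card (C (suc w)) ≤ q * card (restrict w f)
    restrict-large w (yes f) = ≤-trans (proj₂ (proj₂ (proj₂ good)) w f)
      (*-monoʳ-≤ q (count≤card (nbr? (C (suc w)) x₀)))
    restrict-large w (no _)  = m≤n*m _ q ⦃ >-nonZero 0<q ⦄

    C′ : Fin k → Subset n
    C′ w = restrict w (F? zero (suc w))

    rest = embed k (λ u v → F? (suc u) (suc v)) (col ∘ suc) (λ u v → proper (suc u) (suc v))
      C′ (λ w x x∈ → C⊆ (suc w) x (restrict-⊆ w (F? zero (suc w)) x x∈)) (Δ * q)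
      (λ w → ≤-trans (C-large (suc w)) (≤-trans (*-monoʳ-≤ Δ (restrict-large w (F? zero (suc w))))
        (≤-reflexive (sym (*-assoc Δ q _)))))
      (≤-trans (≤-reflexive (*-assoc Δ q (q ^ k))) Δ-small)
      (x₀ ∷ L) (≤-trans (≤-reflexive (sym (+-suc (length L) k))) L-short)

    open Copy rest

    φ₀ : Fin (suc k) → Fin n
    φ₀ zero    = x₀
    φ₀ (suc v) = φ v

    φ₀∈ : ∀ v → φ₀ v ∈ C v
    φ₀∈ zero    = proj₁ (proj₂ good)
    φ₀∈ (suc v) = restrict-⊆ v (F? zero (suc v)) (φ v) (φ-∈ v)

    φ₀-adj : ∀ u v → u F.< v → F u v → Adj (φ₀ u) (φ₀ v)
    φ₀-adj zero    (suc v) _         f = restrict-adj v (F? zero (suc v)) (φ v) (φ-∈ v) f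
    φ₀-adj (suc u) (suc v) (s≤s u<v) f = φ-adj u v u<v f

    φ₀-new : ∀ w → ∃[ L′ ] (¬ Forbidden L′ (φ₀ w) × (∀ {x} → x ∈ₗ L → x ∈ₗ L′) × (∀ u → u F.< w → φ₀ u ∈ₗ L′))
    φ₀-new zero    = L , proj₁ (proj₂ (proj₂ good)) , id , λ u ()
    φ₀-new (suc w) with φ-new w
    ... | L′ , new , L⊆ , earlier =
      L′ , new , L⊆ ∘ there , λ { zero _ → L⊆ (here refl) ; (suc u) (s≤s u<w) → earlier u u<w }

-- Berge copies

member : (S : Subset n) → Fin ∣ S ∣ → Fin n
member (inside ∷ S)  zero    = zero
member (inside ∷ S)  (suc i) = suc (member S i)
member (outside ∷ S) i       = suc (member S i)

member-∈ : (S : Subset n) (i : Fin ∣ S ∣) → member S i ∈ S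
member-∈ (inside ∷ S)  zero    = Vec.here
member-∈ (inside ∷ S)  (suc i) = Vec.there (member-∈ S i)
member-∈ (outside ∷ S) i       = Vec.there (member-∈ S i)

member-injective : (S : Subset n) → Injective _≡_ _≡_ (member S)
member-injective (inside ∷ S)  {zero}  {zero}  _  = refl
member-injective (inside ∷ S)  {suc i} {suc j} eq = cong suc (member-injective S (suc-injective eq))
member-injective (outside ∷ S) eq = member-injective S (suc-injective eq)

index : (S : Subset n) {x : Fin n} → x ∈ S → Fin ∣ S ∣
index (inside ∷ S)  Vec.here       = zero
index (inside ∷ S)  (Vec.there x∈) = suc (index S x∈)
index (outside ∷ S) (Vec.there x∈) = index S x∈

member-index : (S : Subset n) {x : Fin n} (x∈ : x ∈ S) → member S (index S x∈) ≡ x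
member-index (inside ∷ S)  Vec.here       = refl
member-index (inside ∷ S)  (Vec.there x∈) = cong suc (member-index S x∈)
member-index (outside ∷ S) (Vec.there x∈) = cong suc (member-index S x∈)

edge-≡ : ∀ {G} {e e′ : Edge G} → fst e ≡ fst e′ → snd e ≡ snd e′ → e ≡ e′
edge-≡ {G} {e} {e′} refl refl
  with refl ← F.<-irrelevant (fst<snd e) (fst<snd e′)
     | refl ← T-irrelevant (adjacent e) (adjacent e′) = refl

-- A Berge copy needs a bijection between edges and `Fin (size H)`, so the edges are numbered: they
-- are the members of a subset of the codes of ordered pairs. `edges` is |E(G)|.
module EdgeEnumeration (G : Graph) where

  private
    ends : Fin (order G * order G) → Fin (order G) × Fin (order G)
    ends = remQuot (order G)

    edge? : ∀ u → Dec (proj₁ (ends u) F.< proj₂ (ends u) × T (adj G (proj₁ (ends u)) (proj₂ (ends u))))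
    edge? u = proj₁ (ends u) F.<? proj₂ (ends u) ×-dec T? (adj G (proj₁ (ends u)) (proj₂ (ends u)))

    pairs : Subset (order G * order G)
    pairs = ⟨ edge? ⟩

    pair : Edge G → Fin (order G * order G)
    pair e = combine (fst e) (snd e)

    ends-pair : ∀ e → ends (pair e) ≡ (fst e , snd e)
    ends-pair e = remQuot-combine (fst e) (snd e)

    pair∈ : ∀ e → pair e ∈ pairs
    pair∈ e = ∈⟨⟩⁺ edge? (subst (λ (u , v) → u F.< v × T (adj G u v)) (sym (ends-pair e)) (fst<snd e , adjacent e))

  edges : ℕ
  edges = ∣ pairs ∣

  encode : Edge G → Fin edges
  encode e = index pairs (pair∈ e)

  decode : Fin edges → Edge G
  decode j = record { fst = proj₁ (ends u) ; snd = proj₂ (ends u)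
                    ; fst<snd = proj₁ uv-edge ; adjacent = proj₂ uv-edge }
    where
    u = member pairs j
    uv-edge = ∈⟨⟩⁻ edge? (member-∈ pairs j)

  decode-encode : ∀ e → decode (encode e) ≡ e
  decode-encode e = edge-≡ (cong proj₁ ends≡) (cong proj₂ ends≡)
    where
    ends≡ : ends (member pairs (encode e)) ≡ (fst e , snd e)
    ends≡ = trans (cong ends (member-index pairs (pair∈ e))) (ends-pair e)

  encode-decode : ∀ j → encode (decode j) ≡ j
  encode-decode j = member-injective pairs (trans (member-index pairs (pair∈ (decode j)))
    (combine-remQuot {order G} (order G) (member pairs j)))

  encode-injective : Injective _≡_ _≡_ encode
  encode-injective {e} {e′} eq = trans (sym (decode-encode e)) (trans (cong decode eq) (decode-encode e′))

module _ {G : Graph} (H : Hypergraph n) where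

  open EdgeEnumeration G

  -- The subhypergraph keeps exactly the chosen hyperedges, which turns an injective choice into the
  -- required bijection.
  containsBerge : (φ : Fin (order G) → Fin n) → Injective _≡_ _≡_ φ →
    (h : Edge G → Fin (size H)) → Injective _≡_ _≡_ h →
    (∀ a → φ (fst a) ∈ edge H (h a) × φ (snd a) ∈ edge H (h a)) → ContainsBerge G H
  containsBerge φ φ-inj h h-inj φ∈ = H′ , (λ j → h (decode j) , refl) , mk↣ φ-inj ,
    mk⤖ (encode-injective , λ j → decode j , λ { refl → encode-decode j }) , λ a → ends⊆ a
    where
    H′ : Hypergraph n
    H′ = record
      { size = edges
      ; edge = edge H ∘ h ∘ decode
      ; edge-injective = λ {i} {j} eq → trans (sym (encode-decode i))
          (trans (cong encode (h-inj (edge-injective H eq))) (encode-decode j)) }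
    ends⊆ : ∀ a → ⁅ φ (fst a) ⁆ ∪ ⁅ φ (snd a) ⁆ ⊆ edge H (h (decode (encode a)))
    ends⊆ a {x} x∈ rewrite decode-encode a with x∈p∪q⁻ ⁅ φ (fst a) ⁆ ⁅ φ (snd a) ⁆ x∈
    ... | inj₁ x∈₁ with refl ← x∈⁅y⁆⇒x≡y _ x∈₁ = proj₁ (φ∈ a)
    ... | inj₂ x∈₂ with refl ← x∈⁅y⁆⇒x≡y _ x∈₂ = proj₂ (φ∈ a)

-- A system of distinct representatives for the indices in `D`, avoiding `L`. The fixed value
-- outside `D` allows an index to be reserved for a prescribed representative.
record Representatives (i₀ : Fin m) {k} (D : Fin k → Set) (P : Fin k → Fin m → Set) (L : List (Fin m)) : Set where
  field
    h         : Fin k → Fin m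
    h-∈       : ∀ j → D j → P j (h j)
    h-∉       : ∀ j → D j → h j ∉ₗ L
    h-default : ∀ j → ¬ D j → h j ≡ i₀
    h-inj     : ∀ i j → D i → D j → h i ≡ h j → i ≡ j

-- Greedy choice: each pick moves one unit from the number of indices left to the length of the list
-- to be avoided, so the lower bound on the counts persists.
representatives : (i₀ : Fin m) → ∀ k {D : Fin k → Set} (D? : ∀ j → Dec (D j))
  {P : Fin k → Fin m → Set} (P? : ∀ j i → Dec (P j i)) (L : List (Fin m)) →
  (∀ j → D j → length L + k ≤ count (P? j)) → Representatives i₀ D P L
representatives i₀ zero D? P? L many = record
  { h = λ () ; h-∈ = λ () ; h-∉ = λ () ; h-default = λ () ; h-inj = λ () }
representatives {m} i₀ (suc k) {D} D? {P} P? L many with D? zero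
... | no ¬d = record
  { h = λ { zero → i₀ ; (suc j) → h j }
  ; h-∈ = λ { zero d → contradiction d ¬d ; (suc j) → h-∈ j }
  ; h-∉ = λ { zero d → contradiction d ¬d ; (suc j) → h-∉ j }
  ; h-default = λ { zero _ → refl ; (suc j) → h-default j }
  ; h-inj = λ { zero _ d → contradiction d ¬d
              ; (suc _) zero _ d → contradiction d ¬d
              ; (suc i) (suc j) d d′ eq → cong suc (h-inj i j d d′ eq) } }
  where
  open Representatives (representatives i₀ k (D? ∘ suc) (P? ∘ suc) L
    λ j d → ≤-trans (+-monoʳ-≤ (length L) (n≤1+n k)) (many (suc j) d))
... | yes d₀ = record
  { h = λ { zero → proj₁ new ; (suc j) → h j }
  ; h-∈ = λ { zero _ → proj₁ (proj₂ new) ; (suc j) → h-∈ j }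
  ; h-∉ = λ { zero _ → proj₂ (proj₂ new) ; (suc j) d → h-∉ j d ∘ there }
  ; h-default = λ { zero ¬d → contradiction d₀ ¬d ; (suc j) → h-default j }
  ; h-inj = λ { zero zero _ _ _ → refl
              ; zero (suc j) _ d eq → contradiction (here (sym eq)) (h-∉ j d)
              ; (suc i) zero d _ eq → contradiction (here eq) (h-∉ i d)
              ; (suc i) (suc j) d d′ eq → cong suc (h-inj i j d d′ eq) } }
  where
  ∈L? : ∀ x → Dec (x ∈ₗ L)
  ∈L? x = Any.any? (x ≟_) L
  count-L : count ∈L? ≤ length L
  count-L = ≤-trans (count-Any (λ u x → x ≟ u) (λ u → count-unique (λ x → x ≟ u) λ { _ _ refl refl → refl }) L)
    (≤-reflexive (*-identityʳ _))
  new : ∃[ x ] (P zero x × x ∉ₗ L)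
  new = count-excess (P? zero) ∈L? (≤-trans (s≤s count-L)
    (≤-trans (m<m+n (length L) (s≤s z≤n)) (many zero d₀)))
  open Representatives (representatives i₀ k (D? ∘ suc) (P? ∘ suc) (proj₁ new ∷ L)
    λ j d → ≤-trans (≤-reflexive (sym (+-suc (length L) k))) (many (suc j) d))

-- Heavy and light pairs of vertices

module Codegree (H : Hypergraph n) where

  both? : ∀ u v i → Dec (u ∈ edge H i × v ∈ edge H i)
  both? u v i = u ∈? edge H i ×-dec v ∈? edge H i

  codegree : Fin n → Fin n → ℕ
  codegree u v = count (both? u v)

  codegree-sym : ∀ u v → codegree u v ≡ codegree v u
  codegree-sym u v = ≤-antisym (count-mono (both? u v) (both? v u) λ _ (a , b) → b , a)
                               (count-mono (both? v u) (both? u v) λ _ (a , b) → b , a)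

module _ (F : Graph) (e : Edge F) where

  open EdgeEnumeration F

  -- Both edges list their smaller endpoint first, so `a` cannot be `e` reversed.
  other-edge : ∀ a → a ≢ e → T (adj (F ∖ e) (fst a) (snd a))
  other-edge a a≢e with fst a ≟ fst e | snd a ≟ snd e | fst a ≟ snd e | snd a ≟ fst e
  ... | yes p | yes q | _     | _     = contradiction (edge-≡ p q) a≢e
  ... | _     | _     | yes p | yes q = contradiction (fst<snd e) (F.<-asym (subst₂ F._<_ p q (fst<snd a)))
  ... | yes _ | no _  | yes _ | no _  = Equivalence.from T-∧ (adjacent a , _)
  ... | yes _ | no _  | no _  | _     = Equivalence.from T-∧ (adjacent a , _)
  ... | no _  | _     | yes _ | no _  = Equivalence.from T-∧ (adjacent a , _)
  ... | no _  | _     | no _  | _     = Equivalence.from T-∧ (adjacent a , _)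

  module _ (H : Hypergraph n) where

    open Codegree H

    -- The hyperedge i₀ plays the part of e, and heavy pairs leave enough choice for the other edges.
    heavy⇒Berge : ∀ i₀ (ψ : Fin (order F) → Fin n) → Injective _≡_ _≡_ ψ → (∀ v → ψ v ∈ edge H i₀) →
      (∀ u v → T (adj (F ∖ e) u v) → suc edges ≤ codegree (ψ u) (ψ v)) → ContainsBerge F H
    heavy⇒Berge i₀ ψ ψ-inj ψ∈ heavy = containsBerge H ψ ψ-inj (h ∘ encode)
      (λ {a} {b} eq → encode-injective (h-injective (encode a) (encode b) eq)) λ a → h-contains a
      where
      D : Fin edges → Set
      D j = j ≢ encode e
      -- The threshold `suc edges` is `length (i₀ ∷ []) + edges`: one hyperedge to spare for
      -- avoiding `i₀`, and one per edge. The index of `e` lies outside `D` and receives `i₀` by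
      -- default.
      open Representatives (representatives i₀ edges {D} (λ j → ¬? (j ≟ encode e))
        (λ j → both? (ψ (fst (decode j))) (ψ (snd (decode j)))) (i₀ ∷ [])
        λ j j≢ → heavy _ _ (other-edge (decode j) λ eq → j≢ (trans (sym (encode-decode j)) (cong encode eq))))
      h-injective : ∀ i j → h i ≡ h j → i ≡ j
      h-injective i j eq with i ≟ encode e | j ≟ encode e
      ... | yes p | yes q = trans p (sym q)
      ... | yes p | no q  = contradiction (here (trans (sym eq) (h-default i λ ¬p → ¬p p))) (h-∉ j q)
      ... | no p  | yes q = contradiction (here (trans eq (h-default j λ ¬q → ¬q q))) (h-∉ i p)
      ... | no p  | no q  = h-inj i j p q eq
      h-contains : ∀ a → ψ (fst a) ∈ edge H (h (encode a)) × ψ (snd a) ∈ edge H (h (encode a))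
      h-contains a with encode a ≟ encode e
      ... | yes p = subst (λ i → ψ (fst a) ∈ edge H i × ψ (snd a) ∈ edge H i)
                      (sym (h-default (encode a) λ ¬p → ¬p p)) (ψ∈ _ , ψ∈ _)
      ... | no p  = subst (λ b → ψ (fst b) ∈ edge H (h (encode a)) × ψ (snd b) ∈ edge H (h (encode a)))
                      (decode-encode a) (h-∈ (encode a) p)

    record LightClique (c : ℕ) (i : Fin (size H)) : Set where
      field
        b       : Fin c → Fin n
        b-inj   : Injective _≡_ _≡_ b
        b-∈     : ∀ s → b s ∈ edge H i
        b-light : ∀ s t → s ≢ t → codegree (b s) (b t) ≤ edges

    -- Among `N` vertices of the hyperedge, heavy pairs are coloured red and light pairs blue. A red
    -- copy is excluded by `heavy⇒Berge`, so Ramsey's property yields the blue clique.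
    lightClique : ∀ {c N r} → Uniform r H → N ≤ r →
      ((κ : EdgeColouring N) → HasCopy κ blue (K c) ⊎ HasCopy κ red (F ∖ e)) →
      ¬ ContainsBerge F H → ∀ i → LightClique c i
    lightClique {c} {N} uniform N≤r ramsey noBerge i = [ blueCopy , redCopy ]′ (ramsey κ)
      where
      N≤ : N ≤ ∣ edge H i ∣
      N≤ = ≤-trans N≤r (≤-reflexive (sym (uniform i)))
      vertex : Fin N → Fin n
      vertex u = member (edge H i) (inject≤ u N≤)
      vertex-injective : Injective _≡_ _≡_ vertex
      vertex-injective = inject≤-injective N≤ N≤ _ _ ∘ member-injective (edge H i)
      heavy? : ∀ u v → Dec (suc edges ≤ codegree (vertex u) (vertex v))
      heavy? u v = suc edges ≤? codegree (vertex u) (vertex v)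
      κ : EdgeColouring N
      κ = record
        { colour = λ u v → if does (heavy? u v) then red else blue
        ; colour-sym = λ u v → cong (λ d → if does (suc edges ≤? d) then red else blue)
            (codegree-sym (vertex u) (vertex v)) }
      blue⇒light : ∀ {d} (d? : Dec (suc edges ≤ d)) → (if does d? then red else blue) ≡ blue → d ≤ edges
      blue⇒light (no ¬d) _ = ≮⇒≥ ¬d
      red⇒heavy : ∀ {d} (d? : Dec (suc edges ≤ d)) → (if does d? then red else blue) ≡ red → suc edges ≤ d
      red⇒heavy (yes d) _ = d
      K-adj : ∀ s t → s ≢ t → T (adj (K c) s t)
      K-adj s t s≢t with s ≟ t
      ... | yes s≡t = contradiction s≡t s≢t
      ... | no _    = _
      blueCopy : HasCopy κ blue (K c) → LightClique c i
      blueCopy (f , mono) = record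
        { b = vertex ∘ Injection.to f
        ; b-inj = Injection.injective f ∘ vertex-injective
        ; b-∈ = λ s → member-∈ (edge H i) _
        ; b-light = λ s t s≢t → blue⇒light (heavy? _ _) (mono s t (K-adj s t s≢t)) }
      redCopy : HasCopy κ red (F ∖ e) → LightClique c i
      redCopy (f , mono) = contradiction
        (heavy⇒Berge i (vertex ∘ Injection.to f) (Injection.injective f ∘ vertex-injective)
          (λ v → member-∈ (edge H i) _) (λ u v uv → red⇒heavy (heavy? _ _) (mono u v uv)))
        noBerge

-- Blocks and the deletion argument

module BlockSystem {n m c} (b : Fin m → Fin c → Fin n) where

  On : Fin m → Fin n → Set
  On i x = ∃[ s ] b i s ≡ x

  on? : ∀ i x → Dec (On i x)
  on? i x = any? λ s → b i s ≟ x

  common? : ∀ x y i → Dec (On i x × On i y)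
  common? x y i = on? i x ×-dec on? i y

  Adj : Fin n → Fin n → Set
  Adj x y = x ≢ y × ∃[ i ] (On i x × On i y)

  Adj? : ∀ x y → Dec (Adj x y)
  Adj? x y = ¬? (x ≟ y) ×-dec any? (common? x y)

  -- Avoiding the first alternative makes the embedding injective; avoiding the second keeps three
  -- embedded vertices off a common block.
  Joined : Fin n → Fin n → Fin n → Set
  Joined u v x = u ≡ x ⊎ (u ≢ v × ∃[ i ] ((On i u × On i v) × On i x))

  collinear? : ∀ u v x → Dec (u ≢ v × ∃[ i ] ((On i u × On i v) × On i x))
  collinear? u v x = ¬? (u ≟ v) ×-dec any? λ i → common? u v i ×-dec on? i x

  joined? : ∀ u v x → Dec (Joined u v x)
  joined? u v x = u ≟ x ⊎-dec collinear? u v x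

  Forbidden : List (Fin n) → Fin n → Set
  Forbidden L x = Any (λ u → Any (λ v → Joined u v x) L) L

  forbidden? : ∀ L x → Dec (Forbidden L x)
  forbidden? L x = Any.any? (λ u → Any.any? (λ v → joined? u v x) L) L

  module _ {ℓ} (few-common : ∀ x y → x ≢ y → count (common? x y) ≤ ℓ) where

    few-on : ∀ i → count (on? i) ≤ c
    few-on i = ≤-trans (count-⋃ (on? i) (λ s x → b i s ≟ x) (λ _ → id))
      (≤-trans (sum-≤-const λ s → count-unique (λ x → b i s ≟ x) λ { _ _ refl refl → refl })
        (≤-reflexive (*-identityʳ c)))

    few-collinear : ∀ u v → count (collinear? u v) ≤ ℓ * c
    few-collinear u v = case u ≟ v of λ where
        (yes u≡v) → ≤-trans (≤-reflexive (count-none (collinear? u v) λ _ (u≢v , _) → u≢v u≡v)) z≤n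
        (no u≢v)  → begin
          count (collinear? u v)
            ≤⟨ count-⋃ (collinear? u v) (λ i x → common? u v i ×-dec on? i x) (λ _ → proj₂) ⟩
          sum (λ i → count (λ x → common? u v i ×-dec on? i x))
            ≤⟨ sum-mono (λ i → block i (common? u v i)) ⟩
          sum (λ i → 𝟙 (common? u v i) * c)                   ≡⟨ *-distribʳ-sum c (λ i → 𝟙 (common? u v i)) ⟨
          count (common? u v) * c                             ≤⟨ *-monoˡ-≤ c (few-common u v u≢v) ⟩
          ℓ * c                                               ∎
      where
      open ≤-Reasoning
      block : ∀ i (w : Dec (On i u × On i v)) → count (λ x → w ×-dec on? i x) ≤ 𝟙 w * c
      block i (no ¬w) = ≤-reflexive (count-none {n} (λ x → no ¬w ×-dec on? i x) λ _ (w , _) → ¬w w)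
      block i (yes w) = ≤-trans (count-mono (λ x → yes w ×-dec on? i x) (on? i) λ _ → proj₂)
        (≤-trans (few-on i) (≤-reflexive (sym (*-identityˡ c))))

    few-joined : ∀ u v → count (joined? u v) ≤ 1 + ℓ * c
    few-joined u v = ≤-trans (count-⊎ (joined? u v) (u ≟_) (collinear? u v) λ _ → id)
      (+-mono-≤ (count-unique (u ≟_) λ { _ _ refl refl → refl }) (few-collinear u v))

    few-forbidden : ∀ p L → length L ≤ p → count (forbidden? L) ≤ p * (p * (1 + ℓ * c))
    few-forbidden p L L≤p = ≤-trans
      (count-Any (λ u x → Any.any? (λ v → joined? u v x) L)
        (λ u → ≤-trans (count-Any (joined? u) (few-joined u) L) (*-monoˡ-≤ _ L≤p)) L)
      (*-monoˡ-≤ _ L≤p)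

    -- Double counting of the pairs in `D` inside blocks: every block contains one, and every pair
    -- of distinct vertices lies in at most `ℓ` blocks.
    blocks≤edges : {D : Fin n → Fin n → Set} (D? : ∀ x y → Dec (D x y)) →
      (∀ i → ∃[ s ] ∃[ t ] (b i s ≢ b i t × D (b i s) (b i t))) →
      m ≤ ℓ * count₂ (λ x y → Adj? x y ×-dec D? x y)
    blocks≤edges {D} D? hit = begin
      m                                                       ≡⟨ *-identityʳ m ⟨
      m * 1                                                   ≡⟨ sum-const m ⟨
      sum {m} (λ _ → 1)                                       ≤⟨ sum-mono hit′ ⟩
      sum (λ i → sum (λ x → sum (λ y → 𝟙 (at? x y i))))       ≡⟨ ∑-comm (λ i x → sum (λ y → 𝟙 (at? x y i))) ⟩
      sum (λ x → sum (λ i → sum (λ y → 𝟙 (at? x y i))))       ≡⟨ sum-cong-≗ (λ x → ∑-comm (λ i y → 𝟙 (at? x y i))) ⟩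
      sum (λ x → sum (λ y → count (at? x y)))                 ≤⟨ sum-mono (λ x → sum-mono λ y → few x y) ⟩
      sum (λ x → sum (λ y → ℓ * 𝟙 (del? x y)))                ≡⟨ sum-cong-≗ (λ x → *-distribˡ-sum ℓ (λ y → 𝟙 (del? x y))) ⟨
      sum (λ x → ℓ * count (del? x))                          ≡⟨ *-distribˡ-sum ℓ (λ x → count (del? x)) ⟨
      ℓ * count₂ del?                                         ∎
      where
      open ≤-Reasoning
      del? : ∀ x y → Dec (Adj x y × D x y)
      del? x y = Adj? x y ×-dec D? x y
      at? : ∀ x y i → Dec ((On i x × On i y) × (Adj x y × D x y))
      at? x y i = common? x y i ×-dec del? x y
      hit′ : ∀ i → 1 ≤ sum (λ x → sum (λ y → 𝟙 (at? x y i)))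
      hit′ i with s , t , s≢t , dst ← hit i = ≤-trans
        (1≤count (λ y → at? (b i s) y i) (b i t)
          (((s , refl) , (t , refl)) , (s≢t , i , (s , refl) , (t , refl)) , dst))
        (term≤sum (λ x → sum (λ y → 𝟙 (at? x y i))) (b i s))
      few : ∀ x y → count (at? x y) ≤ ℓ * 𝟙 (del? x y)
      few x y = case del? x y of λ where
          (yes del@((x≢y , _) , _)) → ≤-trans (count-mono (at? x y) (common? x y) λ _ → proj₁)
            (≤-trans (few-common x y x≢y) (≤-reflexive (sym (trans
              (cong (ℓ *_) (𝟙-yes (del? x y) del)) (*-identityʳ ℓ)))))
          (no ¬del) → ≤-trans (≤-reflexive (count-none (at? x y) λ _ (_ , w) → ¬del w)) z≤n

  module Rainbow (F : Graph) (φ : Fin (order F) → Fin n)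
    (φ-adj : ∀ u v → u F.< v → T (adj F u v) → Adj (φ u) (φ v))
    (φ-new : ∀ w → ∃[ L ] (¬ Forbidden L (φ w) × (∀ u → u F.< w → φ u ∈ₗ L))) where

    not-joined : ∀ {u v w} → u F.< w → v F.< w → ¬ Joined (φ u) (φ v) (φ w)
    not-joined {w = w} u<w v<w joined with _ , new , earlier ← φ-new w =
      new (lose (earlier _ u<w) (lose (earlier _ v<w) joined))

    φ-injective : Injective _≡_ _≡_ φ
    φ-injective {u} {v} eq with F.<-cmp u v
    ... | tri≈ _ u≡v _ = u≡v
    ... | tri< u<v _ _ = contradiction (inj₁ eq) (not-joined u<v u<v)
    ... | tri> _ _ v<u = contradiction (inj₁ (sym eq)) (not-joined v<u v<u)

    φ-edge : ∀ (x : Edge F) → Adj (φ (fst x)) (φ (snd x))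
    φ-edge x = φ-adj (fst x) (snd x) (fst<snd x) (adjacent x)

    h : Edge F → Fin m
    h x = proj₁ (proj₂ (φ-edge x))

    h-fst : ∀ (x : Edge F) → On (h x) (φ (fst x))
    h-fst x = proj₁ (proj₂ (proj₂ (φ-edge x)))

    h-snd : ∀ (x : Edge F) → On (h x) (φ (snd x))
    h-snd x = proj₂ (proj₂ (proj₂ (φ-edge x)))

    -- Two edges with the same block put three embedded vertices on that block,
    -- the last of which was forbidden by the other two.
    h-not-later : ∀ {x y : Edge F} → h x ≡ h y → ¬ (snd x F.< snd y)
    h-not-later {x} {y} eq lt = not-joined (F.<-trans (fst<snd x) lt) lt
      (inj₂ (proj₁ (φ-edge x) , h x , (h-fst x , h-snd x) , subst (λ i → On i (φ (snd y))) (sym eq) (h-snd y)))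

    h-injective : Injective _≡_ _≡_ h
    h-injective {x} {y} eq with F.<-cmp (snd x) (snd y)
    ... | tri< lt _ _ = contradiction lt (h-not-later {x} {y} eq)
    ... | tri> _ _ gt = contradiction gt (h-not-later {y} {x} (sym eq))
    -- If the larger endpoints agree, different smaller endpoints would again put three embedded
    -- vertices on one block, the common endpoint being the last of them.
    ... | tri≈ _ snd≡ _ with fst x ≟ fst y
    ...   | yes fst≡ = edge-≡ fst≡ snd≡
    ...   | no fst≢  = contradiction
      (inj₂ (fst≢ ∘ φ-injective , h x , (h-fst x , subst (λ i → On i (φ (fst y))) (sym eq) (h-fst y)) , h-snd x))
      (not-joined (fst<snd x) (subst (fst y F.<_) (sym snd≡) (fst<snd y)))

-- Small parts and the bound on the number of hyperedges

module SmallParts {n M} (π : Fin n → Fin M) where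

  open Fibres π

  small? : ∀ E x → Dec (E * part π (π x) ≤ n)
  small? E x = E * part π (π x) ≤? n

  -- Each part contributes either all its vertices, when `E` times its size is at most `n`, or none.
  few-small : ∀ E → E * count (small? E) ≤ M * n
  few-small E = begin
    E * count (small? E)
      ≡⟨ cong (E *_) (sum-fibre (λ x → 𝟙 (small? E x))) ⟨
    E * sum (λ a → sum (λ x → 𝟙 (π x ≟ a) * 𝟙 (small? E x)))
      ≡⟨ *-distribˡ-sum E (λ a → sum (λ x → 𝟙 (π x ≟ a) * 𝟙 (small? E x))) ⟩
    sum (λ a → E * sum (λ x → 𝟙 (π x ≟ a) * 𝟙 (small? E x)))
      ≤⟨ sum-≤-const fibre ⟩
    M * n ∎
    where
    open ≤-Reasoning
    fibre : ∀ a → E * sum (λ x → 𝟙 (π x ≟ a) * 𝟙 (small? E x)) ≤ n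
    fibre a with E * part π a ≤? n
    ... | yes small = ≤-trans (*-monoʳ-≤ E (sum-mono λ x →
            ≤-trans (*-monoʳ-≤ (𝟙 (π x ≟ a)) (𝟙≤1 (small? E x))) (≤-reflexive (*-identityʳ _)))) small
    ... | no ¬small = ≤-trans (*-monoʳ-≤ E (≤-trans (sum-≤-const {k = 0} vanish) (≤-reflexive (*-zeroʳ n))))
            (≤-trans (≤-reflexive (*-zeroʳ E)) z≤n)
      where
      vanish : ∀ x → 𝟙 (π x ≟ a) * 𝟙 (small? E x) ≤ 0
      vanish x with π x ≟ a
      ... | no _ = z≤n
      ... | yes refl = ≤-reflexive (cong (_+ 0) (𝟙-no (small? E x) ¬small))

module HyperedgeBound (F : Graph) (e : Edge F) {c} (colouring : Colourable F c) (E : ℕ) (0<E : 0 < E) where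

  open EdgeEnumeration F

  -- The candidate sets keep a proportion of at least 1 / Q of their parts during the p steps of the
  -- embedding, a step forbids at most β vertices, and there are at most B parts.
  p ℓ Q d β B n₀ : ℕ
  p  = order F
  ℓ  = edges
  Q  = E ^ p
  d  = suc (Q * p)
  β  = p * (p * (1 + ℓ * c))
  B  = suc (partBound (E * (d * d)) 1)
  n₀ = E * B * (d * β * Q)

  col : Fin p → Fin c
  col = proj₁ colouring

  -- The endpoints of `e` have different colours, so a block has at least two vertices. This matters
  -- because smallness of a part enters through `Deleted`, a relation on pairs.
  another : (s : Fin c) → ∃[ t ] s ≢ t
  another s with s ≟ col (fst e)
  ... | yes refl = col (snd e) , proj₂ colouring (fst e) (snd e) (adjacent e)
  ... | no s≢    = col (fst e) , s≢

  module _ {n} (n₀≤n : n₀ ≤ n) (H : Hypergraph n) (noBerge : ¬ ContainsBerge F H)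
           (cliques : ∀ i → LightClique F e H c i) where

    open Codegree H

    b : Fin (size H) → Fin c → Fin n
    b i = LightClique.b (cliques i)

    open BlockSystem b

    on⇒∈ : ∀ {i x} → On i x → x ∈ edge H i
    on⇒∈ {i} (s , refl) = LightClique.b-∈ (cliques i) s

    -- Distinct vertices on a common block form a light pair, and every block through both comes
    -- from a hyperedge containing both.
    few-common : ∀ x y → x ≢ y → count (common? x y) ≤ ℓ
    few-common x y x≢y = case any? (common? x y) of λ where
        (no none) → ≤-trans (≤-reflexive (count-none (common? x y) λ i w → none (i , w))) z≤n
        (yes (i , (s , bs≡x) , (t , bt≡y))) → ≤-trans
          (count-mono (common? x y) (both? x y) λ _ (ox , oy) → on⇒∈ ox , on⇒∈ oy)
          (subst₂ (λ x y → codegree x y ≤ ℓ) bs≡x bt≡y (LightClique.b-light (cliques i) s t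
            λ { refl → x≢y (trans (sym bs≡x) bt≡y) }))

    open Regularity Adj? E d

    module Deletion (partition : RegularPartition E (partBound (E * (d * d)) 1)) where

      open RegularPartition partition
      open SmallParts π using (few-small)

      Small : Fin n → Set
      Small x = E * B * part π (π x) ≤ n

      small? : ∀ x → Dec (Small x)
      small? = SmallParts.small? π (E * B)

      -- Pairs are ordered, so a small part is recorded at the first vertex only: the reversed pair
      -- accounts for the second.
      Deleted : Fin n → Fin n → Set
      Deleted x y = ¬ Live π live x y ⊎ (Live π live x y × Irregular π (π x) (π y)) ⊎ Small x

      deleted? : ∀ x y → Dec (Deleted x y)
      deleted? x y = ¬? (Live? π live x y) ⊎-dec irregular? π live x y ⊎-dec small? x

      deleted-edge? : ∀ x y → Dec (Adj x y × Deleted x y)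
      deleted-edge? x y = Adj? x y ×-dec deleted? x y

      small-edge? : (x y : Fin n) → Dec (Small x × ⊤)
      small-edge? x y = small? x ×-dec yes tt

      -- At most `B` parts have size at most `n` / (`E` `B`) each. `B` is a successor, so it can be
      -- cancelled.
      E*small≤n : E * count small? ≤ n
      E*small≤n = *-cancelˡ-≤ B (begin
        B * (E * count small?)   ≡⟨ *-assoc B E _ ⟨
        B * E * count small?     ≡⟨ cong (_* count small?) (*-comm B E) ⟩
        E * B * count small?     ≤⟨ few-small (E * B) ⟩
        M * n                    ≤⟨ *-monoˡ-≤ n (≤-trans M≤B (n≤1+n _)) ⟩
        B * n                    ∎)
        where open ≤-Reasoning

      few-small-edges : E * count₂ small-edge? ≤ n * n
      few-small-edges = begin
        E * count₂ small-edge?                               ≡⟨ cong (E *_) (count₂-× small? (λ (_ : Fin n) → yes tt)) ⟩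
        E * (count small? * count (λ (_ : Fin n) → yes tt))  ≡⟨ *-assoc E _ _ ⟨
        E * count small? * count (λ (_ : Fin n) → yes tt)    ≤⟨ *-mono-≤ E*small≤n (count≤n (λ (_ : Fin n) → yes tt)) ⟩
        n * n                                                ∎
        where open ≤-Reasoning

      few-deleted : E * count₂ deleted-edge? ≤ 3 * (n * n)
      few-deleted = begin
        E * count₂ deleted-edge?
          ≤⟨ *-monoʳ-≤ E (≤-trans (count₂-⊎ deleted-edge? (dead-edge? π live) rest? split)
               (+-monoʳ-≤ _ (count₂-⊎ rest? (irregular? π live) small-edge?
                 λ { _ _ (inj₁ i) → inj₁ i ; _ _ (inj₂ s) → inj₂ (s , tt) }))) ⟩
        E * (D + (I + S))             ≡⟨ trans (*-distribˡ-+ E D (I + S)) (cong (E * D +_) (*-distribˡ-+ E I S)) ⟩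
        E * D + (E * I + E * S)       ≤⟨ +-mono-≤ few-dead-edges (+-mono-≤ few-irregular few-small-edges) ⟩
        n * n + (n * n + n * n)       ≡⟨ cong (λ z → n * n + (n * n + z)) (+-identityʳ (n * n)) ⟨
        3 * (n * n)                   ∎
        where
        open ≤-Reasoning
        rest? : ∀ x y → Dec ((Live π live x y × Irregular π (π x) (π y)) ⊎ Small x)
        rest? x y = irregular? π live x y ⊎-dec small? x
        split : ∀ x y → Adj x y × Deleted x y →
                (Adj x y × ¬ Live π live x y) ⊎ ((Live π live x y × Irregular π (π x) (π y)) ⊎ Small x)
        split x y (a , inj₁ dead) = inj₁ (a , dead)
        split x y (_ , inj₂ r)    = inj₂ r
        D = count₂ (dead-edge? π live)
        I = count₂ (irregular? π live)
        S = count₂ small-edge?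

      hit? : ∀ i s t → Dec (b i s ≢ b i t × Deleted (b i s) (b i t))
      hit? i s t = ¬? (b i s ≟ b i t) ×-dec deleted? (b i s) (b i t)

      -- In an intact block, different indices give a live and lower-regular pair of parts, and all
      -- parts met are large. So `F` embeds with colour class `s` inside the part `a s`, against
      -- `noBerge`.
      module Surviving (i : Fin (size H)) (intact : ∀ s t → b i s ≢ b i t → ¬ Deleted (b i s) (b i t)) where

        intact′ : ∀ {s t} → s ≢ t → ¬ Deleted (b i s) (b i t)
        intact′ s≢t = intact _ _ (s≢t ∘ LightClique.b-inj (cliques i))

        -- Different indices may share a part: regularity of that part with itself is then
        -- available, as the two block vertices are distinct, and injectivity of the copy comes from
        -- `Forbidden`.
        a : Fin c → Fin M
        a s = π (b i s)

        large : ∀ s → d * β * Q < part π (a s)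
        -- `E * B` times the size of a part that is not small exceeds `n`, hence `n₀`, which carries
        -- the same factor.
        large s with t , s≢t ← another s = *-cancelˡ-< (E * B) _ _
          (≤-<-trans n₀≤n (≰⇒> λ small → intact′ s≢t (inj₂ (inj₂ small))))

        regular : ∀ s t → s ≢ t → ∀ S R → (∀ x → x ∈ S → π x ≡ a s) → (∀ y → y ∈ R → π y ≡ a t) →
                  part π (a s) ≤ d * card S → part π (a t) ≤ d * card R → card S * card R ≤ E * edgesBetween S R
        regular s t s≢t S R S⊆ R⊆ S-large R-large = ≮⇒≥ λ sparse → case Live? π live (b i s) (b i t) of λ where
            (no dead) → intact′ s≢t (inj₁ dead)
            (yes l)   → intact′ s≢t (inj₂ (inj₁ (l , S , R , S⊆ , R⊆ , S-large , R-large , sparse)))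

        open Embedding Adj? E d Q p β 0<E ≤-refl (λ s x → π x ≡ a s) (part π ∘ a) large regular
          Forbidden forbidden? (few-forbidden few-common p)

        part? : ∀ v x → Dec (π x ≡ a (col v))
        part? v x = π x ≟ a (col v)

        copy : Copy (λ u v → T (adj F u v)) (λ v → ⟨ part? v ⟩) []
        copy = embed p (λ u v → T? (adj F u v)) col (proj₂ colouring)
          (λ v → ⟨ part? v ⟩) (λ v x → ∈⟨⟩⁻ (part? v)) 1
          (λ v → ≤-trans (count≤card (part? v)) (≤-reflexive (sym (*-identityˡ _))))
          (≤-reflexive (*-identityˡ _)) [] ≤-refl

        open Copy copy using (φ)
        open Rainbow F φ (Copy.φ-adj copy)
          (λ w → map₂ (λ (new , _ , earlier) → new , earlier) (Copy.φ-new copy w))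

        absurd : ⊥
        absurd = noBerge (containsBerge H φ φ-injective h h-injective λ x → on⇒∈ (h-fst x) , on⇒∈ (h-snd x))

      all-hit : ∀ i → ∃[ s ] ∃[ t ] (b i s ≢ b i t × Deleted (b i s) (b i t))
      all-hit i = case any? (λ s → any? (hit? i s)) of λ where
          (yes hit) → hit
          (no none) → ⊥-elim (Surviving.absurd i λ s t s≢t del → none (s , t , s≢t , del))

      few-hyperedges : E * size H ≤ ℓ * (3 * (n * n))
      few-hyperedges = begin
        E * size H                       ≤⟨ *-monoʳ-≤ E (blocks≤edges few-common deleted? all-hit) ⟩
        E * (ℓ * count₂ deleted-edge?)   ≡⟨ *-assoc E ℓ _ ⟨
        E * ℓ * count₂ deleted-edge?     ≡⟨ cong (_* count₂ deleted-edge?) (*-comm E ℓ) ⟩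
        ℓ * E * count₂ deleted-edge?     ≡⟨ *-assoc ℓ E _ ⟩
        ℓ * (E * count₂ deleted-edge?)   ≤⟨ *-monoʳ-≤ ℓ few-deleted ⟩
        ℓ * (3 * (n * n))                ∎
        where open ≤-Reasoning

    few-hyperedges : E * size H ≤ ℓ * (3 * (n * n))
    few-hyperedges = Deletion.few-hyperedges (regularity Adj? E d E)

-- From the hyperedge bound to the uniformity threshold

edges-nonZero : ∀ {F} → Edge F → NonZero (EdgeEnumeration.edges F)
edges-nonZero {F} e with EdgeEnumeration.edges F | EdgeEnumeration.encode F e
... | suc _ | _ = _

theorem4 : (F : Graph) (e : Edge F) (t c N : ℕ) →
    IsUniformityThreshold F t →
    IsChromaticNumber F c →
    IsRamseyNumber (K c) (F ∖ e) N →
    t ≤ N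
theorem4 F e t c N (_ , t-least) (colouring , _) (ramsey , _) = t-least N λ where
    -- The empty condition `k = 0` is split off because `E k` has to be positive.
    r N≤r zero → 0 , λ n _ m _ → z≤n
    r N≤r k@(suc _) → n₀ k , λ { n n₀≤n m ((H , uniform , noBerge , refl) , _) →
      bound k n n₀≤n H noBerge (lightClique F e H uniform N≤r ramsey noBerge) }
  where
  open EdgeEnumeration F using (edges)
  instance
    edges≢0 : NonZero edges
    edges≢0 = edges-nonZero e

  -- The factor `edges * 3` is the constant of `few-hyperedges`; cancelling it leaves
  -- `k * size H ≤ n ^ 2`.
  E : ℕ → ℕ
  E k = edges * 3 * k

  0<E : ∀ k .⦃ _ : NonZero k ⦄ → 0 < E k
  0<E k = >-nonZero⁻¹ (E k) ⦃ m*n≢0 (edges * 3) k ⦃ m*n≢0 edges 3 ⦄ ⦄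

  n₀ : ∀ k → .⦃ NonZero k ⦄ → ℕ
  n₀ k = HyperedgeBound.n₀ F e colouring (E k) (0<E k)

  bound : ∀ k .⦃ _ : NonZero k ⦄ n → n₀ k ≤ n → (H : Hypergraph n) → ¬ ContainsBerge F H →
          (∀ i → LightClique F e H c i) → k * size H ≤ n ^ 2
  bound k n n₀≤n H noBerge cliques = *-cancelˡ-≤ (edges * 3) ⦃ m*n≢0 edges 3 ⦄ (begin
    edges * 3 * (k * size H)    ≡⟨ *-assoc (edges * 3) k (size H) ⟨
    E k * size H                ≤⟨ HyperedgeBound.few-hyperedges F e colouring (E k) (0<E k) n₀≤n H noBerge cliques ⟩
    edges * (3 * (n * n))       ≡⟨ *-assoc edges 3 (n * n) ⟨
    edges * 3 * (n * n)         ≡⟨ cong (λ z → edges * 3 * (n * z)) (*-identityʳ n) ⟨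
    edges * 3 * (n ^ 2)         ∎)
    where open ≤-Reasoning
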